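{- For $i=1,2$, let $S_i$ be a symmetric finite generating set of a group $G_i$, and let $N_i$ be a finite normal subgroup of $G_i$ such that $G_i/N_i$ is torsion-free nilpotent. Let $\varphi$ be a graph isomorphism from $\mathrm{Cay}(G_1;S_1)$ to $\mathrm{Cay}(G_2;S_2)$. Then $\varphi$ induces a well-defined map $\overline\varphi\colon G_1/N_1\to G_2/N_2$, $\overline\varphi(xN_1)=\varphi(x)N_2$, and $\overline\varphi$ is an affine bijection.
   Context: $\mathrm{Cay}(G;S)$ is the graph with vertex set $G$ in which $g$ is adjacent to $gs$ for all $g\in G$, $s\in S$. A map $\psi\colon H_1\to H_2$ between groups is an affine bijection if there exist a group isomorphism $\alpha\colon H_1\to H_2$ and $h\in H_2$ with $\psi(x)=h\,\alpha(x)$ for all $x\in H_1$. -}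

module Defs where

open import Level using (Level; _⊔_)
open import Data.Nat using (ℕ; zero; suc)
open import Data.List using (List; foldr)
open import Data.List.Relation.Unary.Any using (Any)
open import Data.List.Relation.Unary.All using (All)
open import Data.Product using (Σ; _×_; _,_)
open import Algebra.Bundles using (Group)
open import Algebra.Structures using (IsGroup)
open import Algebra.Morphism.Structures using (module GroupMorphisms)
open import Function.Definitions using (Injective; Surjective; Congruent)

private variable c ℓ c₁ ℓ₁ c₂ ℓ₂ : Level

module _ (G : Group c ℓ) where
  open Group G

  pow : Carrier → ℕ → Carrier
  pow x zero    = ε
  pow x (suc n) = x ∙ pow x n

  TorsionFree : Set (c ⊔ ℓ)
  TorsionFree = ∀ (x : Carrier) (n : ℕ) → pow x (suc n) ≈ ε → x ≈ ε

  commutator : Carrier → Carrier → Carrier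
  commutator a g = a ⁻¹ ∙ g ⁻¹ ∙ a ∙ g

  -- Lower central series: LCS i x  means  x ∈ γ_{i+1}(G),
  -- where γ_1 = G and γ_{i+1} = [γ_i , G] (the subgroup generated by
  -- the commutators [a , g] with a ∈ γ_i, g ∈ G).
  data LCS : ℕ → Carrier → Set (c ⊔ ℓ) where
    base  : ∀ x → LCS zero x
    comm  : ∀ {i a} → LCS i a → ∀ g → LCS (suc i) (commutator a g)
    one   : ∀ {i} → LCS (suc i) ε
    mul   : ∀ {i x y} → LCS (suc i) x → LCS (suc i) y → LCS (suc i) (x ∙ y)
    inv   : ∀ {i x} → LCS (suc i) x → LCS (suc i) (x ⁻¹)
    resp  : ∀ {i x y} → x ≈ y → LCS (suc i) x → LCS (suc i) y

  Nilpotent : Set (c ⊔ ℓ)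
  Nilpotent = Σ ℕ λ k → ∀ x → LCS k x → x ≈ ε

  -- Finite sets of elements are given as lists (read up to _≈_)
  _∈ₗ_ : Carrier → List Carrier → Set (c ⊔ ℓ)
  x ∈ₗ S = Any (λ s → x ≈ s) S

  SymmetricSet : List Carrier → Set (c ⊔ ℓ)
  SymmetricSet S = All (λ s → (s ⁻¹) ∈ₗ S) S

  Generates : List Carrier → Set (c ⊔ ℓ)
  Generates S = ∀ g → Σ (List Carrier) λ w → All (λ s → s ∈ₗ S) w × (g ≈ foldr _∙_ ε w)

  CayAdj : List Carrier → Carrier → Carrier → Set (c ⊔ ℓ)
  CayAdj S g h = Any (λ s → h ≈ g ∙ s) S

  record NormalSubgroup : Set (c ⊔ Level.suc ℓ) where
    field
      member  : Carrier → Set ℓ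
      resp∈   : ∀ {x y} → x ≈ y → member x → member y
      ε∈      : member ε
      ∙∈      : ∀ {x y} → member x → member y → member (x ∙ y)
      ⁻¹∈     : ∀ {x} → member x → member (x ⁻¹)
      conj∈   : ∀ g {x} → member x → member (g ∙ x ∙ g ⁻¹)

  FiniteNormal : NormalSubgroup → Set (c ⊔ ℓ)
  FiniteNormal N = Σ (List Carrier) λ xs → ∀ x → NormalSubgroup.member N x → x ∈ₗ xs

module Quot (G : Group c ℓ) (N : NormalSubgroup G) where
  open Group G
  open NormalSubgroup N
  open import Algebra.Properties.Group G
  open import Relation.Binary.Reasoning.Setoid setoid

  _~_ : Carrier → Carrier → Set ℓ
  x ~ y = member (x ⁻¹ ∙ y)

  ≈⇒~ : ∀ {x y} → x ≈ y → x ~ y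
  ≈⇒~ {x} {y} x≈y = resp∈ (sym (trans (∙-congˡ (sym x≈y)) (inverseˡ x))) ε∈

  ~-refl : ∀ {x} → x ~ x
  ~-refl {x} = ≈⇒~ {x} {x} refl

  ~-sym : ∀ {x y} → x ~ y → y ~ x
  ~-sym {x} {y} h = resp∈ eq (⁻¹∈ h)
    where
      eq : (x ⁻¹ ∙ y) ⁻¹ ≈ y ⁻¹ ∙ x
      eq = trans (⁻¹-anti-homo-∙ (x ⁻¹) y) (∙-congˡ (⁻¹-involutive x))

  ~-trans : ∀ {x y z} → x ~ y → y ~ z → x ~ z
  ~-trans {x} {y} {z} h k = resp∈ eq (∙∈ h k)
    where
      eq : (x ⁻¹ ∙ y) ∙ (y ⁻¹ ∙ z) ≈ x ⁻¹ ∙ z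
      eq = begin
        (x ⁻¹ ∙ y) ∙ (y ⁻¹ ∙ z) ≈⟨ assoc (x ⁻¹) y (y ⁻¹ ∙ z) ⟩
        x ⁻¹ ∙ (y ∙ (y ⁻¹ ∙ z)) ≈⟨ ∙-congˡ (sym (assoc y (y ⁻¹) z)) ⟩
        x ⁻¹ ∙ ((y ∙ y ⁻¹) ∙ z) ≈⟨ ∙-congˡ (∙-congʳ (inverseʳ y)) ⟩
        x ⁻¹ ∙ (ε ∙ z)          ≈⟨ ∙-congˡ (identityˡ z) ⟩
        x ⁻¹ ∙ z ∎

  ~-∙-cong : ∀ {x x' y y'} → x ~ x' → y ~ y' → (x ∙ y) ~ (x' ∙ y')
  ~-∙-cong {x} {x'} {y} {y'} h k = resp∈ eq (∙∈ (conj∈ (y ⁻¹) h) k)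
    where
      a = x ⁻¹ ∙ x'
      eq : y ⁻¹ ∙ a ∙ y ⁻¹ ⁻¹ ∙ (y ⁻¹ ∙ y') ≈ (x ∙ y) ⁻¹ ∙ (x' ∙ y')
      eq = begin
        y ⁻¹ ∙ a ∙ y ⁻¹ ⁻¹ ∙ (y ⁻¹ ∙ y')     ≈⟨ assoc (y ⁻¹ ∙ a) (y ⁻¹ ⁻¹) (y ⁻¹ ∙ y') ⟩
        (y ⁻¹ ∙ a) ∙ (y ⁻¹ ⁻¹ ∙ (y ⁻¹ ∙ y')) ≈⟨ ∙-congˡ (sym (assoc (y ⁻¹ ⁻¹) (y ⁻¹) y')) ⟩
        (y ⁻¹ ∙ a) ∙ ((y ⁻¹ ⁻¹ ∙ y ⁻¹) ∙ y') ≈⟨ ∙-congˡ (∙-congʳ (inverseˡ (y ⁻¹))) ⟩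
        (y ⁻¹ ∙ a) ∙ (ε ∙ y')                ≈⟨ ∙-congˡ (identityˡ y') ⟩
        (y ⁻¹ ∙ a) ∙ y'                      ≈⟨ assoc (y ⁻¹) a y' ⟩
        y ⁻¹ ∙ (a ∙ y')                      ≈⟨ ∙-congˡ (assoc (x ⁻¹) x' y') ⟩
        y ⁻¹ ∙ (x ⁻¹ ∙ (x' ∙ y'))            ≈⟨ sym (assoc (y ⁻¹) (x ⁻¹) (x' ∙ y')) ⟩
        (y ⁻¹ ∙ x ⁻¹) ∙ (x' ∙ y')            ≈⟨ ∙-congʳ (sym (⁻¹-anti-homo-∙ x y)) ⟩
        (x ∙ y) ⁻¹ ∙ (x' ∙ y') ∎

  ~-⁻¹-cong : ∀ {x y} → x ~ y → (x ⁻¹) ~ (y ⁻¹)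
  ~-⁻¹-cong {x} {y} h = resp∈ eq (conj∈ x (~-sym {x} {y} h))
    where
      eq : x ∙ (y ⁻¹ ∙ x) ∙ x ⁻¹ ≈ x ⁻¹ ⁻¹ ∙ y ⁻¹
      eq = begin
        x ∙ (y ⁻¹ ∙ x) ∙ x ⁻¹   ≈⟨ assoc x (y ⁻¹ ∙ x) (x ⁻¹) ⟩
        x ∙ ((y ⁻¹ ∙ x) ∙ x ⁻¹) ≈⟨ ∙-congˡ (assoc (y ⁻¹) x (x ⁻¹)) ⟩
        x ∙ (y ⁻¹ ∙ (x ∙ x ⁻¹)) ≈⟨ ∙-congˡ (∙-congˡ (inverseʳ x)) ⟩
        x ∙ (y ⁻¹ ∙ ε)          ≈⟨ ∙-congˡ (identityʳ (y ⁻¹)) ⟩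
        x ∙ y ⁻¹                ≈⟨ ∙-congʳ (sym (⁻¹-involutive x)) ⟩
        x ⁻¹ ⁻¹ ∙ y ⁻¹ ∎

  quotientGroup : Group c ℓ
  quotientGroup = record
    { Carrier = Carrier
    ; _≈_ = _~_
    ; _∙_ = _∙_
    ; ε = ε
    ; _⁻¹ = _⁻¹
    ; isGroup = record
      { isMonoid = record
        { isSemigroup = record
          { isMagma = record
            { isEquivalence = record
              { refl = λ {x} → ~-refl {x}
              ; sym = λ {x} {y} → ~-sym {x} {y}
              ; trans = λ {x} {y} {z} → ~-trans {x} {y} {z} }
            ; ∙-cong = λ {x} {x'} {y} {y'} → ~-∙-cong {x} {x'} {y} {y'} }
          ; assoc = λ x y z → ≈⇒~ (assoc x y z) }
        ; identity = (λ x → ≈⇒~ (identityˡ x)) , (λ x → ≈⇒~ (identityʳ x)) }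
      ; inverse = (λ x → ≈⇒~ (inverseˡ x)) , (λ x → ≈⇒~ (inverseʳ x))
      ; ⁻¹-cong = λ {x} {y} → ~-⁻¹-cong {x} {y} }
    }

infixl 7 _/_
_/_ : (G : Group c ℓ) → NormalSubgroup G → Group c ℓ
G / N = Quot.quotientGroup G N

record IsCayleyIso (G₁ : Group c₁ ℓ₁) (S₁ : List (Group.Carrier G₁))
                   (G₂ : Group c₂ ℓ₂) (S₂ : List (Group.Carrier G₂))
                   (φ : Group.Carrier G₁ → Group.Carrier G₂)
                   : Set (c₁ ⊔ ℓ₁ ⊔ c₂ ⊔ ℓ₂) where
  field
    cong       : Congruent (Group._≈_ G₁) (Group._≈_ G₂) φ
    injective  : Injective (Group._≈_ G₁) (Group._≈_ G₂) φ
    surjective : Surjective (Group._≈_ G₁) (Group._≈_ G₂) φ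
    adj⇒       : ∀ g h → CayAdj G₁ S₁ g h → CayAdj G₂ S₂ (φ g) (φ h)
    adj⇐       : ∀ g h → CayAdj G₂ S₂ (φ g) (φ h) → CayAdj G₁ S₁ g h

AffineBijection : (H₁ : Group c₁ ℓ₁) (H₂ : Group c₂ ℓ₂) →
                  (Group.Carrier H₁ → Group.Carrier H₂) → Set (c₁ ⊔ ℓ₁ ⊔ c₂ ⊔ ℓ₂)
AffineBijection H₁ H₂ ψ =
  Σ (Group.Carrier H₁ → Group.Carrier H₂) λ α →
    GroupMorphisms.IsGroupIsomorphism (Group.rawGroup H₁) (Group.rawGroup H₂) α ×
    Σ (Group.Carrier H₂) λ h → ∀ x → Group._≈_ H₂ (ψ x) (Group._∙_ H₂ h (α x))

InducesWellDefined : (G₁ : Group c₁ ℓ₁) (N₁ : NormalSubgroup G₁)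
                     (G₂ : Group c₂ ℓ₂) (N₂ : NormalSubgroup G₂) →
                     (Group.Carrier G₁ → Group.Carrier G₂) → Set (c₁ ⊔ ℓ₁ ⊔ ℓ₂)
InducesWellDefined G₁ N₁ G₂ N₂ φ =
  ∀ x y → Group._≈_ (G₁ / N₁) x y → Group._≈_ (G₂ / N₂) (φ x) (φ y)

{-# OPTIONS --safe #-}
module Submission where

open import Defs
open import Level using (Level; _⊔_; Lift; lift; lower)
open import Algebra.Bundles using (Group; AbelianGroup)
import Algebra.Properties.Group
open import Algebra.Morphism.Structures using (module GroupMorphisms)
open import Algebra.Structures using (IsGroup)
open import Data.Bool using (Bool; true; false; not)
open import Data.Fin using (Fin; zero; suc; toℕ)
import Data.Fin.Properties as Fin
open import Data.List using (List; []; _∷_; _++_; map; foldr; length; concatMap; cartesianProductWith)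
open import Data.List.Relation.Unary.All as All using (All; []; _∷_)
open import Data.List.Membership.Propositional using (find)
open import Data.List.Membership.Propositional.Properties using (∈-∃++)
open import Data.List.Properties using (map-∘; map-++; length-++)
open import Data.List.Relation.Unary.All.Properties using (map⁺; ++⁺; ++⁻ˡ; ++⁻ʳ) renaming (map⁻ to map⁻ᵃ)
open import Data.List.Relation.Unary.Any as Any using (Any; here; there)
open import Data.List.Relation.Unary.Any.Properties using (lookup-index; map⁻; cartesianProductWith⁺; concatMap⁺) renaming (map⁺ to map⁺ₐ)
import Data.List.Relation.Binary.Permutation.Homogeneous as Permutation
open import Data.List.Relation.Binary.Pointwise.Base using ([])
import Data.List.Membership.Setoid.Properties
open import Data.List.Relation.Unary.AllPairs as AllPairs using (AllPairs; []; _∷_)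
import Data.List.Relation.Unary.AllPairs.Properties as AllPairs
open import Data.Nat using (ℕ; zero; suc; _+_)
open import Data.Nat.Properties using (n<1+n; +-comm; m≤n⇒∃[o]m+o≡n; +-suc; suc-injective)
open import Data.Product using (∃; ∃₂; _×_; _,_; proj₁; proj₂)
open import Data.Sum using (_⊎_; inj₁; inj₂)
open import Data.Vec using (Vec; lookup)
open import Function using (_∘_; id; const; _⟨_⟩_)
import Relation.Binary.Reflection
import Relation.Binary.Reasoning.Setoid
open import Relation.Binary.Bundles using (Setoid)
open import Relation.Binary.PropositionalEquality as ≡ using (_≡_)
open import Relation.Nullary using (yes; no)

private variable
  a b c r ℓ c₁ ℓ₁ c₂ ℓ₂ : Level

-- Let φ be an isomorphism of the Cayley graphs, z central modulo N₁, and
-- b(x) = φ(x)⁻¹ φ(z x), which takes finitely many values. Along the edges at x, both φ and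
-- φ(z ·) run through S₂ exactly once. If b is already known to be constant modulo some term of
-- the upper central series of G₂/N₂, comparing the two runs shows that its component in the next
-- central factor is a harmonic function. That factor is torsion-free abelian, so a finite set of
-- values has an extreme point and the maximum principle makes b constant; since S₂ is finite and
-- roots are unique, the constant is central. Hence φ descends to the quotients by the centers,
-- where it is affine by induction. The defect of affinity of φ itself is central and constant on
-- cosets of the center, so along an edge it changes by a translation preserving a finite set,
-- that is, not at all.

-- Deciding equations in free groups

-- Equality in the groups is not assumed decidable, yet the argument picks extreme points, removes
-- repetitions from lists and counts values that are only known classically. Equality `x ~ y` in the
-- quotients is therefore replaced by `T P (x ~ y)` for an arbitrary `P`. This relation is stable,
-- so classical steps may be used in proving it, and taking `P` to be the desired equality itself
-- recovers the actual statement. The induction follows iterated quotients by the center.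
-- Nilpotency, given through the lower central series, only bounds their number; that each of them
-- again has a torsion-free center is deduced from the previous one. Edges at a vertex biject with
-- generators only where distinct generators are kept apart, and a quotient may identify them. What
-- is passed down to quotients is thus a permutation of lists, which keeps multiplicities.

module GroupSolver (G : Group c ℓ) where
  open Group G
  open import Algebra.Properties.Group G
  open Relation.Binary.Reasoning.Setoid setoid

  infixr 5 _⊕_
  infix 8 _⁻

  data Expr (n : ℕ) : Set where
    var : Fin n → Expr n
    𝟙   : Expr n
    _⊕_ : Expr n → Expr n → Expr n
    _⁻  : Expr n → Expr n

  Letter : ℕ → Set
  Letter n = Bool × Fin n

  private variable n : ℕ

  ⟦_⟧ : Expr n → Vec Carrier n → Carrier
  ⟦ var i ⟧ ρ = lookup ρ i
  ⟦ 𝟙 ⟧ ρ = ε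
  ⟦ x ⊕ y ⟧ ρ = ⟦ x ⟧ ρ ∙ ⟦ y ⟧ ρ
  ⟦ x ⁻ ⟧ ρ = ⟦ x ⟧ ρ ⁻¹

  signed : Bool → Carrier → Carrier
  signed true  x = x
  signed false x = x ⁻¹

  ⟦_⟧ʷ : List (Letter n) → Vec Carrier n → Carrier
  ⟦ [] ⟧ʷ ρ = ε
  ⟦ (s , i) ∷ w ⟧ʷ ρ = signed s (lookup ρ i) ∙ ⟦ w ⟧ʷ ρ

  push : Letter n → List (Letter n) → List (Letter n)
  push l [] = l ∷ []
  push (true , i) ((true , j) ∷ w) = (true , i) ∷ (true , j) ∷ w
  push (false , i) ((false , j) ∷ w) = (false , i) ∷ (false , j) ∷ w
  push (true , i) ((false , j) ∷ w) with i Fin.≟ j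
  ... | yes _ = w
  ... | no  _ = (true , i) ∷ (false , j) ∷ w
  push (false , i) ((true , j) ∷ w) with i Fin.≟ j
  ... | yes _ = w
  ... | no  _ = (false , i) ∷ (true , j) ∷ w

  push-correct : ∀ (l : Letter n) w ρ → ⟦ push l w ⟧ʷ ρ ≈ signed (proj₁ l) (lookup ρ (proj₂ l)) ∙ ⟦ w ⟧ʷ ρ
  push-correct l [] ρ = refl
  push-correct (true , i) ((true , j) ∷ w) ρ = refl
  push-correct (false , i) ((false , j) ∷ w) ρ = refl
  push-correct (true , i) ((false , j) ∷ w) ρ with i Fin.≟ j
  ... | no  _ = refl
  ... | yes ≡.refl = sym (trans (sym (assoc _ _ _)) (trans (∙-congʳ (inverseʳ _)) (identityˡ _)))
  push-correct (false , i) ((true , j) ∷ w) ρ with i Fin.≟ j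
  ... | no  _ = refl
  ... | yes ≡.refl = sym (trans (sym (assoc _ _ _)) (trans (∙-congʳ (inverseˡ _)) (identityˡ _)))

  -- The flag is the sign under which the expression is read and the list is the suffix already
  -- reduced; carrying both avoids inverting and concatenating words.
  reduce : Expr n → Bool → List (Letter n) → List (Letter n)
  reduce (var i) s w = push (s , i) w
  reduce 𝟙 s w = w
  reduce (x ⊕ y) true w = reduce x true (reduce y true w)
  reduce (x ⊕ y) false w = reduce y false (reduce x false w)
  reduce (x ⁻) s w = reduce x (not s) w

  signed-⁻¹ : ∀ s x → signed (not s) x ≈ signed s (x ⁻¹)
  signed-⁻¹ true  x = refl
  signed-⁻¹ false x = sym (⁻¹-involutive x)

  reduce-correct : ∀ (e : Expr n) s w ρ → ⟦ reduce e s w ⟧ʷ ρ ≈ signed s (⟦ e ⟧ ρ) ∙ ⟦ w ⟧ʷ ρ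
  reduce-correct (var i) s w ρ = push-correct (s , i) w ρ
  reduce-correct 𝟙 true w ρ = sym (identityˡ _)
  reduce-correct 𝟙 false w ρ = sym (trans (∙-congʳ ε⁻¹≈ε) (identityˡ _))
  reduce-correct (x ⊕ y) true w ρ = begin
    ⟦ reduce x true (reduce y true w) ⟧ʷ ρ ≈⟨ reduce-correct x true _ ρ ⟩
    ⟦ x ⟧ ρ ∙ ⟦ reduce y true w ⟧ʷ ρ       ≈⟨ ∙-congˡ (reduce-correct y true w ρ) ⟩
    ⟦ x ⟧ ρ ∙ (⟦ y ⟧ ρ ∙ ⟦ w ⟧ʷ ρ)         ≈⟨ assoc _ _ _ ⟨
    ⟦ x ⟧ ρ ∙ ⟦ y ⟧ ρ ∙ ⟦ w ⟧ʷ ρ           ∎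
  reduce-correct (x ⊕ y) false w ρ = begin
    ⟦ reduce y false (reduce x false w) ⟧ʷ ρ ≈⟨ reduce-correct y false _ ρ ⟩
    ⟦ y ⟧ ρ ⁻¹ ∙ ⟦ reduce x false w ⟧ʷ ρ     ≈⟨ ∙-congˡ (reduce-correct x false w ρ) ⟩
    ⟦ y ⟧ ρ ⁻¹ ∙ (⟦ x ⟧ ρ ⁻¹ ∙ ⟦ w ⟧ʷ ρ)     ≈⟨ assoc _ _ _ ⟨
    ⟦ y ⟧ ρ ⁻¹ ∙ ⟦ x ⟧ ρ ⁻¹ ∙ ⟦ w ⟧ʷ ρ       ≈⟨ ∙-congʳ (⁻¹-anti-homo-∙ _ _) ⟨
    (⟦ x ⟧ ρ ∙ ⟦ y ⟧ ρ) ⁻¹ ∙ ⟦ w ⟧ʷ ρ        ∎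
  reduce-correct (x ⁻) s w ρ = trans (reduce-correct x (not s) w ρ) (∙-congʳ (signed-⁻¹ s _))

  open Relation.Binary.Reflection setoid var ⟦_⟧ (λ e → ⟦ reduce e true [] ⟧ʷ)
    (λ e ρ → trans (reduce-correct e true [] ρ) (identityʳ _)) public using (solve; _⊜_)

-- Powers, conjugation and unique roots.

module Powers (G : Group c ℓ) where
  open Group G
  open GroupSolver G

  pow-cong : ∀ {x y} n → x ≈ y → pow G x n ≈ pow G y n
  pow-cong zero    e = refl
  pow-cong (suc n) e = ∙-cong e (pow-cong n e)

  pow-ε : ∀ n → pow G ε n ≈ ε
  pow-ε zero    = refl
  pow-ε (suc n) = trans (identityˡ _) (pow-ε n)

  pow-+ : ∀ x m n → pow G x (m + n) ≈ pow G x m ∙ pow G x n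
  pow-+ x zero    n = sym (identityˡ _)
  pow-+ x (suc m) n = trans (∙-congˡ (pow-+ x m n)) (sym (assoc _ _ _))

  pow-comm : ∀ {x y} n → x ∙ y ≈ y ∙ x → pow G x n ∙ y ≈ y ∙ pow G x n
  pow-comm zero    e = trans (identityˡ _) (sym (identityʳ _))
  pow-comm {x} {y} (suc n) e = trans (assoc _ _ _) (trans (∙-congˡ (pow-comm n e))
    (trans (sym (assoc _ _ _)) (trans (∙-congʳ e) (assoc _ _ _))))

  pow-∙ : ∀ {x y} n → x ∙ y ≈ y ∙ x → pow G (x ∙ y) n ≈ pow G x n ∙ pow G y n
  pow-∙ zero e = sym (identityˡ _)
  pow-∙ {x} {y} (suc n) e = trans (∙-congˡ (pow-∙ n e))
    (trans (solve 4 (λ x y p r → (x ⊕ y) ⊕ (p ⊕ r) ⊜ x ⊕ ((y ⊕ p) ⊕ r)) refl x y _ _)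
    (trans (∙-congˡ (∙-congʳ (sym (pow-comm n e))))
    (solve 4 (λ x y p r → x ⊕ ((p ⊕ y) ⊕ r) ⊜ (x ⊕ p) ⊕ (y ⊕ r)) refl x y _ _)))

  pow-conj : ∀ x t n → pow G (t ⁻¹ ∙ x ∙ t) n ≈ t ⁻¹ ∙ pow G x n ∙ t
  pow-conj x t zero = solve 1 (λ t → 𝟙 ⊜ ((t ⁻) ⊕ 𝟙) ⊕ t) refl t
  pow-conj x t (suc n) = trans (∙-congˡ (pow-conj x t n))
    (solve 3 (λ x t p → (((t ⁻) ⊕ x) ⊕ t) ⊕ (((t ⁻) ⊕ p) ⊕ t) ⊜ ((t ⁻) ⊕ (x ⊕ p)) ⊕ t) refl x t _)

  UniqueRoots : Set _
  UniqueRoots = ∀ x y n → pow G x (suc n) ≈ pow G y (suc n) → x ≈ y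

  uniqueRoots⇒torsionFree : UniqueRoots → TorsionFree G
  uniqueRoots⇒torsionFree ur x n e = ur x ε n (trans e (sym (pow-ε (suc n))))

  -- If a power of `w` commutes with `t`, then `w` and its conjugate by `t` are roots of the same
  -- element, hence equal.
  uniqueRoots⇒isolated : UniqueRoots → ∀ w t n → pow G w (suc n) ∙ t ≈ t ∙ pow G w (suc n) → w ∙ t ≈ t ∙ w
  uniqueRoots⇒isolated ur w t n e = trans
      (solve 2 (λ w t → w ⊕ t ⊜ t ⊕ (((t ⁻) ⊕ w) ⊕ t)) refl w t)
      (∙-congˡ (ur _ _ n (trans (pow-conj w t (suc n))
        (trans (assoc _ _ _) (trans (∙-congˡ e) (solve 2 (λ t p → (t ⁻) ⊕ (t ⊕ p) ⊜ p) refl t _))))))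

-- Centers and towers of centers

Central : (G : Group c ℓ) → Group.Carrier G → Set (c ⊔ ℓ)
Central G z = ∀ g → z ∙ g ≈ g ∙ z
  where open Group G

module _ (G : Group c ℓ) where
  open Group G
  open GroupSolver G

  central-resp : ∀ {x y} → x ≈ y → Central G x → Central G y
  central-resp e h g = trans (∙-congʳ (sym e)) (trans (h g) (∙-congˡ e))

  central-ε : Central G ε
  central-ε g = trans (identityˡ g) (sym (identityʳ g))

  central-∙ : ∀ {x y} → Central G x → Central G y → Central G (x ∙ y)
  central-∙ h k g = trans (assoc _ _ _) (trans (∙-congˡ (k g)) (trans (sym (assoc _ _ _))
    (trans (∙-congʳ (h g)) (assoc _ _ _))))

  central-⁻¹ : ∀ {x} → Central G x → Central G (x ⁻¹)
  central-⁻¹ {x} h g = trans (solve 2 (λ x g → (x ⁻) ⊕ g ⊜ (x ⁻) ⊕ ((g ⊕ x) ⊕ (x ⁻))) refl x g)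
    (trans (∙-congˡ (∙-congʳ (sym (h g)))) (solve 2 (λ x g → (x ⁻) ⊕ ((x ⊕ g) ⊕ (x ⁻)) ⊜ g ⊕ (x ⁻)) refl x g))

  central-conj : ∀ g {x} → Central G x → g ∙ x ∙ g ⁻¹ ≈ x
  central-conj g {x} h = trans (∙-congʳ (sym (h g))) (solve 2 (λ x g → (x ⊕ g) ⊕ (g ⁻) ⊜ x) refl x g)

-- NormalSubgroup asks for membership in the level of the equality, which therefore
-- has to absorb the quantification over the carrier.
center : ∀ q (G : Group c (c ⊔ q)) → NormalSubgroup G
center q G = record
  { member = Central G
  ; resp∈  = central-resp G
  ; ε∈     = central-ε G
  ; ∙∈     = central-∙ G
  ; ⁻¹∈    = central-⁻¹ G
  ; conj∈  = λ g h → central-resp G (Group.sym G (central-conj G g h)) h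
  }

TorsionFreeCenter : Group c ℓ → Set (c ⊔ ℓ)
TorsionFreeCenter G = ∀ z n → Central G z → pow G z (suc n) ≈ ε → z ≈ ε
  where open Group G

-- The upper central series exhausts the group within `k` steps and has torsion-free factors.
-- Encoding it by iterated quotients lets every induction recurse on a group with the same carrier.
CentralTower : ∀ q → ℕ → Group c (c ⊔ q) → Set (c ⊔ q)
CentralTower q zero    G = ∀ x → x ≈ ε
  where open Group G
CentralTower q (suc k) G = TorsionFreeCenter G × CentralTower q k (G / center q G)

pow-/ : (G : Group c ℓ) (N : NormalSubgroup G) → ∀ x n → pow (G / N) x n ≡ pow G x n
pow-/ G N x zero    = ≡.refl
pow-/ G N x (suc n) = ≡.cong (Group._∙_ G x) (pow-/ G N x n)

module _ (q : Level) where

  -- Modulo the center the roots agree by induction, so `y` is `x` times a central `z`. Then the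
  -- powers differ by the power of `z`, which is trivial, and `z` vanishes because the center is
  -- torsion-free.
  tower⇒uniqueRoots : ∀ k (G : Group c (c ⊔ q)) → CentralTower q k G → Powers.UniqueRoots G
  tower⇒uniqueRoots zero G triv x y n e = Group.trans G (triv x) (Group.sym G (triv y))
  tower⇒uniqueRoots (suc k) G (tf , tower) x y n e = sym y≈x
    where
    open Group G
    open GroupSolver G
    open Powers G
    open import Algebra.Properties.Group G
    z = x ⁻¹ ∙ y
    z-central : Central G z
    z-central = tower⇒uniqueRoots k (G / center q G) tower x y n
      (≡.subst₂ (Group._≈_ (G / center q G)) (≡.sym (pow-/ G (center q G) x (suc n))) (≡.sym (pow-/ G (center q G) y (suc n)))
        (Quot.≈⇒~ G (center q G) e))
    y≈xz : y ≈ x ∙ z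
    y≈xz = solve 2 (λ x y → y ⊜ x ⊕ ((x ⁻) ⊕ y)) refl x y
    zⁿ : pow G z (suc n) ≈ ε
    zⁿ = sym (∙-cancelˡ (pow G x (suc n)) _ _ (trans (identityʳ _) (trans e (trans (pow-cong (suc n) y≈xz)
         (pow-∙ (suc n) (sym (z-central x)))))))
    y≈x : y ≈ x
    y≈x = trans y≈xz (trans (∙-congˡ (tf z n z-central zⁿ)) (identityʳ x))

  -- If `x` is central modulo the center, its commutator `k` with any `g` is central, and `shift`
  -- shows that the commutator of a power of `x` with `g` is the same power of `k`. A central power
  -- of `x` thus makes `k` torsion, hence trivial.
  torsionFreeCenter-/ : (G : Group c (c ⊔ q)) → TorsionFreeCenter G → TorsionFreeCenter (G / center q G)
  torsionFreeCenter-/ G tf x n x-central xⁿ = Quot.~-sym G (center q G) {ε} {x}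
      (central-resp G (solve 1 (λ x → x ⊜ (𝟙 ⁻) ⊕ x) refl x) x-central′)
    where
    open Group G
    open GroupSolver G
    open Powers G
    open import Algebra.Properties.Group G
    module _ (g : Carrier) where
      k = (x ∙ g) ⁻¹ ∙ (g ∙ x)
      kc : Central G k
      kc = x-central g
      shift : ∀ m → g ∙ pow G x m ≈ pow G x m ∙ g ∙ pow G k m
      shift zero = solve 1 (λ g → g ⊕ 𝟙 ⊜ (𝟙 ⊕ g) ⊕ 𝟙) refl g
      shift (suc m) = trans (solve 3 (λ x g p → g ⊕ (x ⊕ p) ⊜ x ⊕ (g ⊕ ((((x ⊕ g) ⁻) ⊕ (g ⊕ x)) ⊕ p))) refl x g _)
        (trans (∙-congˡ (∙-congˡ (kc _)))
        (trans (∙-congˡ (sym (assoc _ _ _)))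
        (trans (∙-congˡ (∙-congʳ (shift m)))
        (trans (∙-congˡ (assoc _ _ _)) (trans (∙-congˡ (∙-congˡ (sym (kc _)))) (sym (trans (∙-congʳ (assoc _ _ _)) (assoc _ _ _)))))))) 
      xⁿ-central : Central G (pow G x (suc n))
      xⁿ-central = central-resp G (solve 1 (λ p → ((p ⁻) ⊕ 𝟙) ⁻ ⊜ p) refl _) (central-⁻¹ G
        (≡.subst (λ p → Central G (p ⁻¹ ∙ ε)) (pow-/ G (center q G) x (suc n)) xⁿ))
      kⁿ : pow G k (suc n) ≈ ε
      kⁿ = sym (∙-cancelˡ (pow G x (suc n) ∙ g) _ _ (trans (identityʳ _) (trans (xⁿ-central g) (shift (suc n)))))
      x-central′ : x ∙ g ≈ g ∙ x
      x-central′ = trans (sym (identityʳ _)) (trans (∙-congˡ (sym (tf k n kc kⁿ)))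
        (solve 2 (λ x g → (x ⊕ g) ⊕ (((x ⊕ g) ⁻) ⊕ (g ⊕ x)) ⊜ g ⊕ x) refl x g))

  LCS-/ : (G : Group c ℓ) (N : NormalSubgroup G) → ∀ {k x} → LCS (G / N) k x →
          ∃ λ y → LCS G k y × Group._≈_ (G / N) y x
  LCS-/ G N (base x) = x , base x , Group.refl (G / N)
  LCS-/ G N (comm h g) = let y , l , e = LCS-/ G N h in commutator G y g , comm l g ,
    Group.∙-cong (G / N) (Group.∙-cong (G / N) (Group.∙-cong (G / N) (Group.⁻¹-cong (G / N) e) (Group.refl (G / N))) e) (Group.refl (G / N))
  LCS-/ G N one = _ , one , Group.refl (G / N)
  LCS-/ G N (mul h k) = let y , l , e = LCS-/ G N h ; y′ , l′ , e′ = LCS-/ G N k in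
    _ , mul l l′ , Group.∙-cong (G / N) e e′
  LCS-/ G N (inv h) = let y , l , e = LCS-/ G N h in _ , inv l , Group.⁻¹-cong (G / N) e
  LCS-/ G N (resp e′ h) = let y , l , e = LCS-/ G N h in y , l , Group.trans (G / N) e e′

  -- This trades the lower central series for the upper one: when the next term is trivial, the
  -- elements of `LCS G k` have trivial commutators, so they are central and disappear in the
  -- quotient.
  nilpotent⇒tower : ∀ k (G : Group c (c ⊔ q)) → TorsionFreeCenter G →
                    (∀ x → LCS G k x → Group._≈_ G x (Group.ε G)) → CentralTower q k G
  nilpotent⇒tower zero G tf h x = h x (base x)
  nilpotent⇒tower (suc k) G tf h = tf , nilpotent⇒tower k (G / center q G) (torsionFreeCenter-/ G tf) λ x l →
    let y , l′ , e = LCS-/ G (center q G) l in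
    Group.trans (G / center q G) (Group.sym (G / center q G) {y} {x} e) (central-resp G (sym (identityʳ _)) (central-⁻¹ G (y-central y l′)))
    where
    open Group G
    open GroupSolver G
    y-central : ∀ y → LCS G k y → Central G y
    y-central y l g = sym (trans (solve 2 (λ y g → g ⊕ y ⊜ y ⊕ (g ⊕ ((((((g ⁻) ⊕ (y ⁻)) ⊕ g) ⊕ y))))) refl y g)
      (trans (∙-congˡ (∙-congˡ (trans (solve 2 (λ y g → (((g ⁻) ⊕ (y ⁻)) ⊕ g) ⊕ y ⊜ ((((y ⁻) ⊕ (g ⁻)) ⊕ y) ⊕ g) ⁻) refl y g)
        (trans (⁻¹-cong (h _ (comm l g))) (solve 0 (𝟙 ⁻ ⊜ 𝟙) refl))))) (∙-congˡ (identityʳ g))))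

-- Products over lists in abelian groups and in centers.

module Products (A : AbelianGroup c ℓ) where
  open AbelianGroup A
  open GroupSolver group
  open import Algebra.Properties.AbelianGroup A using (⁻¹-∙-comm)
  open import Algebra.Properties.CommutativeSemigroup commutativeSemigroup using (interchange)
  open import Data.List.Relation.Binary.Permutation.Setoid setoid using (_↭_)
  open import Data.List.Relation.Binary.Permutation.Setoid.Properties setoid using (foldr-commMonoid)

  private variable
    X Y : Set a

  ∏ : (X → Carrier) → List X → Carrier
  ∏ f xs = foldr _∙_ ε (map f xs)

  ∏-cong : ∀ {f g : X → Carrier} {xs} → All (λ x → f x ≈ g x) xs → ∏ f xs ≈ ∏ g xs
  ∏-cong []       = refl
  ∏-cong (e ∷ es) = ∙-cong e (∏-cong es)

  ∏-∙ : ∀ (f g : X → Carrier) xs → ∏ (λ x → f x ∙ g x) xs ≈ ∏ f xs ∙ ∏ g xs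
  ∏-∙ f g []       = sym (identityˡ ε)
  ∏-∙ f g (x ∷ xs) = trans (∙-congˡ (∏-∙ f g xs)) (interchange (f x) (g x) _ _)

  ∏-⁻¹ : ∀ (f : X → Carrier) xs → ∏ (λ x → f x ⁻¹) xs ≈ ∏ f xs ⁻¹
  ∏-⁻¹ f []       = solve 0 (𝟙 ⊜ 𝟙 ⁻) refl
  ∏-⁻¹ f (x ∷ xs) = trans (∙-congˡ (∏-⁻¹ f xs)) (⁻¹-∙-comm _ _)

  ∏-++ : ∀ (f : X → Carrier) xs ys → ∏ f (xs ++ ys) ≈ ∏ f xs ∙ ∏ f ys
  ∏-++ f []       ys = sym (identityˡ _)
  ∏-++ f (x ∷ xs) ys = trans (∙-congˡ (∏-++ f xs ys)) (sym (assoc _ _ _))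

  ∏-map : ∀ (f : Y → Carrier) (g : X → Y) xs → ∏ f (map g xs) ≡ ∏ (f ∘ g) xs
  ∏-map f g xs = ≡.cong (foldr _∙_ ε) (≡.sym (map-∘ xs))

  ∏-↭ : ∀ {xs ys} → xs ↭ ys → foldr _∙_ ε xs ≈ foldr _∙_ ε ys
  ∏-↭ = foldr-commMonoid isCommutativeMonoid

  ∏-const : ∀ x (ys : List X) → ∏ (const x) ys ≡ pow group x (length ys)
  ∏-const x []       = ≡.refl
  ∏-const x (y ∷ ys) = ≡.cong (x ∙_) (∏-const x ys)

  ∏-const-ε : ∀ (ys : List X) → ∏ (const ε) ys ≈ ε
  ∏-const-ε []       = refl
  ∏-const-ε (y ∷ ys) = trans (identityˡ _) (∏-const-ε ys)

centerGroup : Group c ℓ → AbelianGroup (c ⊔ ℓ) ℓ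
centerGroup G = record
  { Carrier = ∃ (Central G)
  ; _≈_ = λ x y → proj₁ x ≈ proj₁ y
  ; _∙_ = λ x y → proj₁ x ∙ proj₁ y , central-∙ G (proj₂ x) (proj₂ y)
  ; ε = ε , central-ε G
  ; _⁻¹ = λ x → proj₁ x ⁻¹ , central-⁻¹ G (proj₂ x)
  ; isAbelianGroup = record
    { isGroup = record
      { isMonoid = record
        { isSemigroup = record
          { isMagma = record
            { isEquivalence = record { refl = refl ; sym = sym ; trans = trans }
            ; ∙-cong = ∙-cong }
          ; assoc = λ _ _ _ → assoc _ _ _ }
        ; identity = (λ _ → identityˡ _) , (λ _ → identityʳ _) }
      ; inverse = (λ _ → inverseˡ _) , (λ _ → inverseʳ _)
      ; ⁻¹-cong = ⁻¹-cong }
    ; comm = λ x y → proj₂ x (proj₁ y) }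
  }
  where open Group G

pow-center : (G : Group c ℓ) → ∀ z n → proj₁ (pow (AbelianGroup.group (centerGroup G)) z n) ≡ pow G (proj₁ z) n
pow-center G z zero    = ≡.refl
pow-center G z (suc n) = ≡.cong (Group._∙_ G (proj₁ z)) (pow-center G z n)

module _ (G : Group c ℓ) where
  open Group G
  open AbelianGroup (centerGroup G) using () renaming (Carrier to Z; _≈_ to _≈ᶻ_; _∙_ to _∙ᶻ_; ε to εᶻ; setoid to setoidᶻ)
  open Products (centerGroup G)
  open import Data.List.Relation.Binary.Permutation.Setoid setoid using (_↭_; ↭-sym; ↭-trans)
  open import Data.List.Relation.Binary.Permutation.Setoid.Properties setoid using (shift; drop-∷; ∈-resp-↭)
  import Data.List.Relation.Binary.Permutation.Setoid.Properties setoidᶻ as ↭ᶻ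
  open import Algebra.Properties.Group G

  translate : Carrier × Z → Carrier
  translate (t , z) = t ∙ proj₁ z

  -- Induction on the length: if the translate of the head is the first component of a later
  -- pair, the two pairs are merged into one by composing their translations.
  translation-total : ∀ ps → map proj₁ ps ↭ map translate ps → ∏ proj₂ ps ≈ᶻ εᶻ
  translation-total ps = go (length ps) ps ≡.refl
    where
    go : ∀ n ps → length ps ≡ n → map proj₁ ps ↭ map translate ps → ∏ proj₂ ps ≈ᶻ εᶻ
    go n [] e p = refl
    go (suc n) ((t , z) ∷ ps) e p with ∈-resp-↭ (↭-sym p) (here refl)
    ... | here tz≈t = trans (∙-cong z≈ε (go n ps (suc-injective e) (drop-∷ (↭-trans p (prep tz≈t ↭-refl))))) (identityˡ ε)
      where
      open import Data.List.Relation.Binary.Permutation.Setoid setoid using (prep; ↭-refl)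
      z≈ε : proj₁ z ≈ ε
      z≈ε = ∙-cancelˡ t _ _ (trans tz≈t (sym (identityʳ t)))
    ... | there i with find (map⁻ i)
    ... | (t′ , z′) , j , tz≈t′ with ∈-∃++ j
    ... | qs , rs , ≡.refl = trans (∙-congˡ (trans (Products.∏-↭ (centerGroup G) (↭-trans′ (reflexive′ (map-++ proj₂ qs _)) (↭ᶻ.↭-shift (map proj₂ qs) (map proj₂ rs))))
           (∙-congˡ (reflexive (≡.cong (λ l → proj₁ (foldr _∙ᶻ_ εᶻ l)) (≡.sym (map-++ proj₂ qs rs)))))))
           (trans (sym (assoc _ _ _)) rec)
      where
      open import Data.List.Relation.Binary.Permutation.Setoid setoidᶻ using () renaming (↭-trans to ↭-trans′; ↭-reflexive to reflexive′)
      p′ : t ∷ map proj₁ (qs ++ rs) ↭ t ∙ (proj₁ z ∙ proj₁ z′) ∷ map translate (qs ++ rs)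
      p′ = ≡.subst₂ (λ xs ys → t ∷ xs ↭ t ∙ (proj₁ z ∙ proj₁ z′) ∷ ys) (≡.sym (map-++ proj₁ qs rs)) (≡.sym (map-++ translate qs rs))
        (drop-∷ (↭-trans (↭-sym (shift (sym tz≈t′) (t ∷ map proj₁ qs) (map proj₁ rs)))
          (↭-trans (≡.subst₂ (λ xs ys → t ∷ xs ↭ t ∙ proj₁ z ∷ ys) (map-++ proj₁ qs _) (map-++ translate qs _) p)
            (shift (trans (∙-congʳ (sym tz≈t′)) (assoc _ _ _)) (t ∙ proj₁ z ∷ map translate qs) (map translate rs)
             ⟨ ↭-trans ⟩ ↭-swap _ _ ↭-refl))))
        where open import Data.List.Relation.Binary.Permutation.Setoid setoid using (↭-swap; ↭-refl)
      length′ : suc (length (qs ++ rs)) ≡ n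
      length′ = suc-injective (≡.trans (≡.cong suc (≡.trans (≡.cong suc (length-++ qs)) (≡.trans (≡.sym (+-suc _ _)) (≡.sym (length-++ qs))))) e)
      rec : proj₁ z ∙ proj₁ z′ ∙ proj₁ (∏ proj₂ (qs ++ rs)) ≈ ε
      rec = go n ((t , z ∙ᶻ z′) ∷ (qs ++ rs)) length′ p′

-- Cayley graphs

⊆-trans : (S : Setoid c ℓ) → let open Setoid S in {xs ys : List Carrier} {x : Carrier} →
          All (λ x → Any (x ≈_) ys) xs → Any (x ≈_) xs → Any (x ≈_) ys
⊆-trans S (i ∷ _)  (here e)  = Any.map (Setoid.trans S e) i
⊆-trans S (_ ∷ is) (there j) = ⊆-trans S is j

module CayleyGraph (G : Group c ℓ) where
  open Group G
  open GroupSolver G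

  private variable
    S S′ : List Carrier
    g g′ h h′ s : Carrier

  adj-resp : g ≈ g′ → h ≈ h′ → CayAdj G S g h → CayAdj G S g′ h′
  adj-resp e e′ = Any.map λ i → trans (sym e′) (trans i (∙-congʳ e))

  ∈⇒adj : _∈ₗ_ G s S → CayAdj G S g (g ∙ s)
  ∈⇒adj = Any.map ∙-congˡ

  adj⇒∈ : CayAdj G S g h → _∈ₗ_ G (g ⁻¹ ∙ h) S
  adj⇒∈ = Any.map λ e → trans (∙-congˡ e) (solve 2 (λ g s → (g ⁻) ⊕ (g ⊕ s) ⊜ s) refl _ _)

  ∈⇒adj′ : _∈ₗ_ G (g ⁻¹ ∙ h) S → CayAdj G S g h
  ∈⇒adj′ i = adj-resp refl (solve 2 (λ g h → g ⊕ ((g ⁻) ⊕ h) ⊜ h) refl _ _) (∈⇒adj i)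

  adj-mono : All (λ s → _∈ₗ_ G s S′) S → CayAdj G S g h → CayAdj G S′ g h
  adj-mono S⊆S′ i = ∈⇒adj′ (⊆-trans setoid S⊆S′ (adj⇒∈ i))

  generates-mono : All (λ s → _∈ₗ_ G s S′) S → Generates G S → Generates G S′
  generates-mono S⊆S′ generates x = let w , w⊆S , e = generates x in w , All.map (⊆-trans setoid S⊆S′) w⊆S , e

  ⁻¹-∈ : SymmetricSet G S → _∈ₗ_ G s S → _∈ₗ_ G (s ⁻¹) S
  ⁻¹-∈ (i ∷ _)  (here e)  = Any.map (trans (⁻¹-cong e)) i
  ⁻¹-∈ symmetric (there j) = go symmetric j
    where
    go : ∀ {S S′} → All (λ s → _∈ₗ_ G (s ⁻¹) S) (s ∷ S′) → _∈ₗ_ G h S′ → _∈ₗ_ G (h ⁻¹) S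
    go (_ ∷ (i ∷ _)) (here e) = Any.map (trans (⁻¹-cong e)) i
    go (i ∷ (_ ∷ is)) (there j) = go (i ∷ is) j

  symmetric-mono : All (λ s → _∈ₗ_ G s S′) S → All (λ s → _∈ₗ_ G s S) S′ → SymmetricSet G S → SymmetricSet G S′
  symmetric-mono S⊆S′ S′⊆S symmetric = All.map (⊆-trans setoid S⊆S′ ∘ ⁻¹-∈ symmetric) S′⊆S

  words : List Carrier → ℕ → List Carrier
  words S zero    = ε ∷ []
  words S (suc n) = cartesianProductWith _∙_ S (words S n)

-- Only the equality is enlarged, while carrier and operations stay. Maps, generating lists and
-- stars can then be read modulo a subgroup, or up to `T`, without being transported.
record Coarsening (G : Group c ℓ) r : Set (c ⊔ ℓ ⊔ Level.suc r) where
  open Group G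
  field
    _≈′_    : Carrier → Carrier → Set r
    isGroup′ : IsGroup _≈′_ _∙_ ε _⁻¹
    ≈⇒≈′    : ∀ {x y} → x ≈ y → x ≈′ y

  coarse : Group c r
  coarse = record { isGroup = isGroup′ }

  generates-coarse : ∀ {S} → Generates G S → Generates coarse S
  generates-coarse generates x = let w , w⊆S , e = generates x in w , All.map (Any.map ≈⇒≈′) w⊆S , ≈⇒≈′ e

  symmetric-coarse : ∀ {S} → SymmetricSet G S → SymmetricSet coarse S
  symmetric-coarse = All.map (Any.map ≈⇒≈′)

open Coarsening using (coarse)

trivial : (G : Group c ℓ) → Coarsening G ℓ
trivial G = record { isGroup′ = Group.isGroup G ; ≈⇒≈′ = id }

quotient : (G : Group c ℓ) (N : NormalSubgroup G) → Coarsening G ℓ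
quotient G N = record { isGroup′ = Group.isGroup (G / N) ; ≈⇒≈′ = Quot.≈⇒~ G N }

module CayleyIso (G₁ : Group c₁ ℓ₁) (G₂ : Group c₂ ℓ₂) where

  open Group G₁ using () renaming (Carrier to X₁; _≈_ to _≈₁_; _∙_ to _∙₁_; ε to ε₁; _⁻¹ to _⁻¹₁)
  open Group G₂ using () renaming (Carrier to X₂; _≈_ to _≈₂_; _∙_ to _∙₂_; ε to ε₂; _⁻¹ to _⁻¹₂)

  private
    module G₁ = Group G₁
    module G₂ = Group G₂
    module Cay₁ = CayleyGraph G₁
    module Cay₂ = CayleyGraph G₂
    module Solve₁ = GroupSolver G₁

  module _ {S₁ S₂ φ} (iso : IsCayleyIso G₁ S₁ G₂ S₂ φ) where
    open IsCayleyIso iso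

    φ⁻¹ : X₂ → X₁
    φ⁻¹ y = proj₁ (surjective y)

    φφ⁻¹ : ∀ y → φ (φ⁻¹ y) ≈₂ y
    φφ⁻¹ y = proj₂ (surjective y) G₁.refl

    φ⁻¹φ : ∀ x → φ⁻¹ (φ x) ≈₁ x
    φ⁻¹φ x = injective (φφ⁻¹ (φ x))

    inverse : IsCayleyIso G₂ S₂ G₁ S₁ φ⁻¹
    inverse = record
      { cong = λ {x} {y} e → injective (G₂.trans (φφ⁻¹ x) (G₂.trans e (G₂.sym (φφ⁻¹ y))))
      ; injective = λ {x} {y} e → G₂.trans (G₂.sym (φφ⁻¹ x)) (G₂.trans (cong e) (φφ⁻¹ y))
      ; surjective = λ x → φ x , λ {z} e → injective (G₂.trans (φφ⁻¹ z) e)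
      ; adj⇒ = λ g h i → adj⇐ _ _ (Cay₂.adj-resp (G₂.sym (φφ⁻¹ g)) (G₂.sym (φφ⁻¹ h)) i)
      ; adj⇐ = λ g h i → Cay₂.adj-resp (φφ⁻¹ g) (φφ⁻¹ h) (adj⇒ _ _ i) }

    iso-mono : ∀ {S₁′ S₂′} → All (λ s → _∈ₗ_ G₁ s S₁) S₁′ → All (λ s → _∈ₗ_ G₁ s S₁′) S₁ →
      All (λ s → _∈ₗ_ G₂ s S₂) S₂′ → All (λ s → _∈ₗ_ G₂ s S₂′) S₂ → IsCayleyIso G₁ S₁′ G₂ S₂′ φ
    iso-mono S₁′⊆S₁ S₁⊆S₁′ S₂′⊆S₂ S₂⊆S₂′ = record
      { cong = cong ; injective = injective ; surjective = surjective
      ; adj⇒ = λ g h → Cay₂.adj-mono S₂⊆S₂′ ∘ adj⇒ g h ∘ Cay₁.adj-mono S₁′⊆S₁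
      ; adj⇐ = λ g h → Cay₁.adj-mono S₁⊆S₁′ ∘ adj⇐ g h ∘ Cay₂.adj-mono S₂′⊆S₂ }

    -- A coarse edge from `g` is a true edge from `g` followed by a coarse equality at its end. So
    -- adjacency transfers as soon as `φ` respects and reflects the coarse equalities.
    iso-coarse : ∀ {r₁ r₂} (C₁ : Coarsening G₁ r₁) (C₂ : Coarsening G₂ r₂) →
      (∀ {x y} → Coarsening._≈′_ C₁ x y → Coarsening._≈′_ C₂ (φ x) (φ y)) →
      (∀ {x y} → Coarsening._≈′_ C₂ (φ x) (φ y) → Coarsening._≈′_ C₁ x y) →
      IsCayleyIso (coarse C₁) S₁ (coarse C₂) S₂ φ
    iso-coarse C₁ C₂ cong′ injective′ = record
      { cong = cong′
      ; injective = injective′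
      ; surjective = λ y → φ⁻¹ y , λ e → Group.trans (coarse C₂) (cong′ e) (Coarsening.≈⇒≈′ C₂ (φφ⁻¹ y))
      ; adj⇒ = λ g h i → let s , s∈S , e = step (coarse C₁) i in
          CayleyGraph.adj-resp (coarse C₂) (Group.refl (coarse C₂)) (Group.sym (coarse C₂) (cong′ e))
            (Any.map (Coarsening.≈⇒≈′ C₂) (adj⇒ g (g ∙₁ s) (Cay₁.∈⇒adj (Any.map (λ { ≡.refl → G₁.refl }) s∈S))))
      ; adj⇐ = λ g h i → let s , s∈S , e = step (coarse C₂) i
                             y = φ⁻¹ (φ g ∙₂ s) in
          CayleyGraph.adj-resp (coarse C₁) (Group.refl (coarse C₁))
            (injective′ (Group.trans (coarse C₂) (Coarsening.≈⇒≈′ C₂ (φφ⁻¹ (φ g ∙₂ s))) (Group.sym (coarse C₂) e)))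
            (Any.map (Coarsening.≈⇒≈′ C₁) (adj⇐ g y (Cay₂.adj-resp G₂.refl (G₂.sym (φφ⁻¹ (φ g ∙₂ s)))
              (Cay₂.∈⇒adj (Any.map (λ { ≡.refl → G₂.refl }) s∈S))))) }
      where
      step : ∀ {c ℓ} (H : Group c ℓ) {S g h} → CayAdj H S g h →
             ∃ λ s → Any (s ≡_) S × Group._≈_ H h (Group._∙_ H g s)
      step H (here {x} e) = x , here ≡.refl , e
      step H (there i) = let s , s∈S , e = step H i in s , there s∈S , e

    iso-translate : ∀ z → IsCayleyIso G₁ S₁ G₂ S₂ (φ ∘ (z ∙₁_))
    iso-translate z = record
      { cong = cong ∘ G₁.∙-congˡ
      ; injective = ∙-cancelˡ z _ _ ∘ injective
      ; surjective = λ y → z ⁻¹₁ ∙₁ φ⁻¹ y , λ e → G₂.trans (cong (G₁.trans (G₁.∙-congˡ e)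
          (Solve₁.solve 2 (λ z y → z ⊕ ((z ⁻) ⊕ y) ⊜ y) G₁.refl z _))) (φφ⁻¹ y)
      ; adj⇒ = λ g h → adj⇒ _ _ ∘ Any.map (λ e → G₁.trans (G₁.∙-congˡ e) (G₁.sym (G₁.assoc _ _ _)))
      ; adj⇐ = λ g h → Any.map (λ e → ∙-cancelˡ z _ _ (G₁.trans e (G₁.assoc _ _ _))) ∘ adj⇐ _ _ }
      where
      open import Algebra.Properties.Group G₁
      open Solve₁

    -- A path labelled `w` is mapped to a path of equal length. The list on the right does not
    -- mention `x`, and this uniformity makes displacements take finitely many values.
    displacement-∈-words : ∀ w → All (λ s → _∈ₗ_ G₁ s S₁) w → ∀ x →
      _∈ₗ_ G₂ (φ x ⁻¹₂ ∙₂ φ (x ∙₁ foldr _∙₁_ ε₁ w)) (Cay₂.words S₂ (length w))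
    displacement-∈-words [] [] x = here (G₂.trans (G₂.∙-congˡ (cong (G₁.identityʳ x))) (G₂.inverseˡ _))
    displacement-∈-words (s ∷ w) (i ∷ is) x = ∈-resp-≈ G₂.setoid
      (G₂.trans (solve 3 (λ a b c → ((a ⁻) ⊕ b) ⊕ ((b ⁻) ⊕ c) ⊜ (a ⁻) ⊕ c) G₂.refl _ _ _) (G₂.∙-congˡ (cong (G₁.assoc _ _ _))))
      (cartesianProductWith⁺ _∙₂_ G₂.∙-cong (Cay₂.adj⇒∈ (adj⇒ x (x ∙₁ s) (Cay₁.∈⇒adj i))) (displacement-∈-words w is (x ∙₁ s)))
      where
      open GroupSolver G₂
      open import Data.List.Membership.Setoid.Properties using (∈-resp-≈)

map-↭ : (S : Setoid c ℓ) → let open Setoid S in {X : Set a} {f g : X → Carrier} → (∀ x → f x ≈ g x) →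
        ∀ xs → Permutation.Permutation _≈_ (map f xs) (map g xs)
map-↭ S h []       = Permutation.refl []
map-↭ S h (x ∷ xs) = Permutation.prep (h x) (map-↭ S h xs)

-- Fixing a proposition P, T is the double-negation monad relative to P. Statements that are
-- T-stable can be proved classically, so no equality has to be decidable.
module _ {p : Level} (P : Set p) where

  T : Set a → Set (a ⊔ p)
  T A = (A → P) → P

  Stable : Set a → Set (a ⊔ p)
  Stable A = T A → A

  pure : {A : Set a} → A → T A
  pure x k = k x

  _>>=_ : {A : Set a} {B : Set b} → T A → (A → T B) → T B
  (m >>= f) k = m λ x → f x k

  explode : {A : Set a} → P → T A
  explode x _ = x

  em : (A : Set a) → T (A ⊎ (A → P))
  em A k = k (inj₂ (k ∘ inj₁))

  sequenceAll : {A : Set a} {Q : A → Set b} {xs : List A} → All (T ∘ Q) xs → T (All Q xs)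
  sequenceAll []       = pure []
  sequenceAll (x ∷ xs) = do
    y ← x
    ys ← sequenceAll xs
    pure (y ∷ ys)

  sequenceFin : ∀ n {Q : Fin n → Set a} → (∀ i → T (Q i)) → T (∀ i → Q i)
  sequenceFin zero    h = pure λ ()
  sequenceFin (suc n) h = do
    x ← h zero
    f ← sequenceFin n (h ∘ suc)
    pure λ { zero → x ; (suc i) → f i }

  module _ (S : Setoid c ℓ) where
    open Setoid S
    open import Data.List.Membership.Setoid S using (_∈_)
    open import Data.List.Membership.Setoid.Properties using (∈-resp-≈) renaming (∈-∃++ to ∈-∃++ₛ)
    open import Data.List.Relation.Binary.Permutation.Setoid S using (_↭_; ↭-refl; ↭-sym; ↭-trans; ↭-reflexive-≋; prep)
    open import Data.List.Relation.Binary.Permutation.Setoid.Properties S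

    recurrence : ∀ (L : List Carrier) u → (∀ i → T (u i ∈ L)) → T (∃₂ λ i n → u i ≈ u (i + suc n))
    recurrence L u h = do
      -- Only finitely many witnesses can be taken out of `T` at once; one more than the length of
      -- `L` suffices for the pigeonhole principle.
      f ← sequenceFin (suc (length L)) (h ∘ toℕ)
      let i , j , i<j , e = Fin.pigeonhole (n<1+n _) (Any.index ∘ f)
          n , e′ = m≤n⇒∃[o]m+o≡n i<j
      pure (toℕ i , n ,
        trans (lookup-index (f i)) (trans (reflexive (≡.cong (Data.List.lookup L) e)) (trans (sym (lookup-index (f j)))
          (reflexive (≡.cong u (≡.trans (≡.sym e′) (≡.sym (+-suc (toℕ i) n))))))))

    Distinct : List Carrier → Set _
    Distinct = AllPairs (λ x y → x ≈ y → P)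

    -- A generating list may repeat an element, and then a star need not be a permutation of the
    -- other list; representatives without repetition restore this.
    deduplicate : ∀ xs → T (∃ λ ys → Distinct ys × All (_∈ xs) ys × All (_∈ ys) xs)
    deduplicate [] = pure ([] , [] , [] , [])
    deduplicate (x ∷ xs) = do
      ys , distinct , ys⊆xs , xs⊆ys ← deduplicate xs
      inj₂ x∉ys ← em (x ∈ ys)
        where inj₁ x∈ys → pure (ys , distinct , All.map there ys⊆xs , x∈ys ∷ xs⊆ys)
      pure (x ∷ ys , All.tabulateₛ S (λ y∈ys x≈y → x∉ys (∈-resp-≈ S (sym x≈y) y∈ys)) ∷ distinct ,
            here refl ∷ All.map there ys⊆xs , here refl ∷ All.map there xs⊆ys)

    -- Both lists lose their copy of `x`. By distinctness no remaining element equals `x`, so the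
    -- inclusions persist; a coincidence would yield an element of `P`, which `T` accepts.
    distinct⇒↭ : ∀ {xs ys} → Distinct xs → Distinct ys → (∀ {z} → z ∈ xs → T (z ∈ ys)) →
                 (∀ {z} → z ∈ ys → T (z ∈ xs)) → T (xs ↭ ys)
    distinct⇒↭ {[]} {[]} dx dy xs⊆ys ys⊆xs = pure ↭-refl
    distinct⇒↭ {[]} {y ∷ ys} dx dy xs⊆ys ys⊆xs = do
      () ← ys⊆xs (here refl)
    distinct⇒↭ {x ∷ xs} {ys} (x∉xs ∷ dx) dy xs⊆ys ys⊆xs = do
      x∈ys ← xs⊆ys (here refl)
      let as , bs , w , x≈w , e = ∈-∃++ₛ S x∈ys
          ys↭ = ↭-trans (↭-reflexive-≋ e) (shift (sym x≈w) as bs)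
      x∉ys′ ∷ dy′ ← pure (AllPairs-resp-↭ (_∘ sym) ((λ e k → k ∘ λ e′ → trans e′ (sym e)) , (λ e k → k ∘ trans e)) ys↭ dy)
      let xs⊆ys′ : ∀ {z} → z ∈ xs → T (z ∈ as ++ bs)
          xs⊆ys′ z∈xs = xs⊆ys (there z∈xs) >>= λ z∈ys → case₁ z∈xs (∈-resp-↭ ys↭ z∈ys)
          ys′⊆xs : ∀ {z} → z ∈ as ++ bs → T (z ∈ xs)
          ys′⊆xs z∈ys′ = ys⊆xs (∈-resp-↭ (↭-sym ys↭) (there z∈ys′)) >>= case₂ x∉ys′ z∈ys′
      xs↭ys′ ← distinct⇒↭ dx dy′ xs⊆ys′ ys′⊆xs
      pure (↭-trans (prep refl xs↭ys′) (↭-sym ys↭))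
      where
      separate : ∀ {z zs} → All (λ y → x ≈ y → P) zs → z ∈ zs → z ≈ x → P
      separate (k ∷ _)  (here e)  e′ = k (trans (sym e′) e)
      separate (_ ∷ ks) (there i) e′ = separate ks i e′
      case₁ : ∀ {z zs} → z ∈ xs → z ∈ x ∷ zs → T (z ∈ zs)
      case₁ z∈xs (here e)  = explode (separate x∉xs z∈xs e)
      case₁ z∈xs (there i) = pure i
      case₂ : ∀ {z zs} → All (λ y → x ≈ y → P) zs → z ∈ zs → z ∈ x ∷ xs → T (z ∈ xs)
      case₂ x∉zs z∈zs (here e)  = explode (separate x∉zs z∈zs e)
      case₂ x∉zs z∈zs (there i) = pure i

  -- Extreme points and the maximum principle.

  module Extreme (A : AbelianGroup c ℓ) (stable : ∀ {x y} → Stable (AbelianGroup._≈_ A x y))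
                 (torsionFree : TorsionFree (AbelianGroup.group A)) where
    open AbelianGroup A
    open Products A
    open GroupSolver group
    open import Data.List.Membership.Setoid setoid using (_∈_)
    open Relation.Binary.Reasoning.Setoid setoid

    -- v is not a nontrivial average, with positive rational weights, of elements of vs.
    Extreme : Carrier → List Carrier → Set _
    Extreme v vs = ∀ ws → All (_∈ vs) ws → ∏ (_- v) ws ≈ ε → All (_≈ v) ws

    -- As the list is nonempty, `K` is multiplication by a positive integer, and torsion-freeness
    -- makes its kernel trivial.
    dilate : ∀ {w₀ : Carrier} {ws₀} → let K = λ x → ∏ (const x) (w₀ ∷ ws₀) in ∀ {x} → K x ≈ ε → x ≈ ε
    dilate {w₀} {ws₀} {x} e = torsionFree x (length ws₀) (trans (reflexive (≡.sym (∏-const x (w₀ ∷ ws₀)))) e)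

    cancel : ∀ {x v} → x - v ≈ ε → x ≈ v
    cancel {x} {v} e = trans (solve 2 (λ x v → x ⊜ (x ⊕ (v ⁻)) ⊕ v) refl x v) (trans (∙-congʳ e) (identityˡ v))

    -- If a multiple of u is a sum of elements of us, then a multiple of any sum over u ∷ us
    -- is a sum over us.
    module Replace {u us w₀ ws₀} (ws₀⊆us : All (_∈ us) (w₀ ∷ ws₀)) (average : ∏ (_- u) (w₀ ∷ ws₀) ≈ ε) (v : Carrier) where

      K : Carrier → Carrier
      K x = ∏ (const x) (w₀ ∷ ws₀)

      replace : ∀ {ws} → All (_∈ u ∷ us) ws → ∃ λ xs → All (_∈ us) xs ×
                ∏ (_- v) xs ≈ K (∏ (_- v) ws) × (All (_≈ v) xs → All (_≈ v) ws)
      replace [] = [] , [] , sym (∏-const-ε (w₀ ∷ ws₀)) , λ _ → []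
      replace {w ∷ ws} (here w≈u ∷ h) = let xs , xs⊆us , e , f = replace h in
        (w₀ ∷ ws₀) ++ xs , ++⁺ ws₀⊆us xs⊆us , (begin
          ∏ (_- v) ((w₀ ∷ ws₀) ++ xs)         ≈⟨ ∏-++ (_- v) (w₀ ∷ ws₀) xs ⟩
          ∏ (_- v) (w₀ ∷ ws₀) ∙ ∏ (_- v) xs   ≈⟨ ∙-cong sum-u e ⟩
          K (w - v) ∙ K (∏ (_- v) ws)         ≈⟨ ∏-∙ (const (w - v)) (const (∏ (_- v) ws)) (w₀ ∷ ws₀) ⟨
          K ((w - v) ∙ ∏ (_- v) ws)             ∎) ,
        λ all → (trans w≈u (u≈v (++⁻ˡ (w₀ ∷ ws₀) all))) ∷ f (++⁻ʳ (w₀ ∷ ws₀) all)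
        where
        sum-u : ∏ (_- v) (w₀ ∷ ws₀) ≈ K (w - v)
        sum-u = begin
          ∏ (_- v) (w₀ ∷ ws₀)                 ≈⟨ ∏-cong {f = _- v} {xs = w₀ ∷ ws₀} (All.universal (λ x → trans
              (solve 3 (λ x u v → x ⊕ (v ⁻) ⊜ (x ⊕ (u ⁻)) ⊕ (u ⊕ (v ⁻))) refl x u v) (∙-congˡ (∙-congʳ (sym w≈u)))) _) ⟩
          ∏ (λ x → (x - u) ∙ (w - v)) (w₀ ∷ ws₀) ≈⟨ ∏-∙ (_- u) (const (w - v)) (w₀ ∷ ws₀) ⟩
          ∏ (_- u) (w₀ ∷ ws₀) ∙ K (w - v)     ≈⟨ ∙-congʳ average ⟩
          ε ∙ K (w - v)                       ≈⟨ identityˡ _ ⟩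
          K (w - v)                           ∎
        u≈v : All (_≈ v) (w₀ ∷ ws₀) → u ≈ v
        u≈v all = sym (cancel (dilate {w₀} {ws₀} (trans (∏-cong {f = const (v - u)} {xs = w₀ ∷ ws₀} (All.map (λ e → ∙-congʳ (sym e)) all)) average)))
      replace {w ∷ ws} (there w∈us ∷ h) = let xs , xs⊆us , e , f = replace h in
        map (const w) (w₀ ∷ ws₀) ++ xs , ++⁺ (map⁺ (All.universal (const w∈us) (w₀ ∷ ws₀))) xs⊆us , (begin
          ∏ (_- v) (map (const w) (w₀ ∷ ws₀) ++ xs)         ≈⟨ ∏-++ (_- v) (map (const w) (w₀ ∷ ws₀)) xs ⟩
          ∏ (_- v) (map (const w) (w₀ ∷ ws₀)) ∙ ∏ (_- v) xs ≈⟨ ∙-cong (reflexive (∏-map (_- v) (const w) (w₀ ∷ ws₀))) e ⟩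
          K (w - v) ∙ K (∏ (_- v) ws)                       ≈⟨ ∏-∙ (const (w - v)) (const (∏ (_- v) ws)) (w₀ ∷ ws₀) ⟨
          K ((w - v) ∙ ∏ (_- v) ws)                           ∎) ,
        λ all → All.head all ∷ f (++⁻ʳ (map (const w) (w₀ ∷ ws₀)) all)

    -- Entries equal to `u` contribute nothing to a sum of differences with `u`. What remains is
    -- either empty or a nonempty relation exhibiting `u` as an average of `us`.
    withoutHead : ∀ {u us ws} → All (_∈ u ∷ us) ws → ∃ λ xs → All (_∈ us) xs ×
                  ∏ (_- u) xs ≈ ∏ (_- u) ws × (xs ≡ [] → All (_≈ u) ws)
    withoutHead [] = [] , [] , refl , λ _ → []
    withoutHead {u} {us} {w ∷ ws} (here w≈u ∷ h) = let xs , xs⊆us , e , f = withoutHead h in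
      xs , xs⊆us , trans e (sym (trans (∙-congʳ (trans (∙-congʳ w≈u) (inverseʳ u))) (identityˡ _))) , λ e′ → w≈u ∷ f e′
    withoutHead {ws = w ∷ ws} (there w∈us ∷ h) = let xs , xs⊆us , e , f = withoutHead h in
      w ∷ xs , w∈us ∷ xs⊆us , ∙-congˡ e , λ ()

    -- This replaces the choice of a maximum, as the group carries no order. If `u` is an average of
    -- the others, relations over the longer list reduce by `Replace` to relations over the others,
    -- so their extreme point remains extreme. If it is not, `u` itself is extreme.
    existsExtreme : ∀ u us → T (∃ λ v → v ∈ u ∷ us × Extreme v (u ∷ us))
    existsExtreme u [] = pure (u , here refl , λ ws ws⊆ _ → All.map (λ { (here e) → e }) ws⊆)
    existsExtreme u (u′ ∷ us) = do
      v , v∈ , extreme ← existsExtreme u′ us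
      em (∃₂ λ w₀ ws₀ → All (_∈ u′ ∷ us) (w₀ ∷ ws₀) × ∏ (_- u) (w₀ ∷ ws₀) ≈ ε) >>= λ where
        (inj₁ (w₀ , ws₀ , ws₀⊆us , average)) → pure (v , there v∈ , λ ws ws⊆ e →
          let open Replace ws₀⊆us average v
              xs , xs⊆us , e′ , f = replace ws⊆
          in f (extreme xs xs⊆us (trans e′ (trans (∏-cong {xs = w₀ ∷ ws₀} (All.universal (const e) _)) (∏-const-ε (w₀ ∷ ws₀))))))
        (inj₂ none) → pure (u , here refl , λ ws ws⊆ e → case-extreme none (withoutHead ws⊆) e)
      where
      case-extreme : ∀ {ws} → ((∃₂ λ w₀ ws₀ → All (_∈ u′ ∷ us) (w₀ ∷ ws₀) × ∏ (_- u) (w₀ ∷ ws₀) ≈ ε) → P) →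
        (∃ λ xs → All (_∈ u′ ∷ us) xs × ∏ (_- u) xs ≈ ∏ (_- u) ws × (xs ≡ [] → All (_≈ u) ws)) →
        ∏ (_- u) ws ≈ ε → All (_≈ u) ws
      case-extreme none ([] , _ , _ , f) e = f ≡.refl
      case-extreme none (x ∷ xs , xs⊆us , e′ , f) e =
        All.universal (λ _ → stable (explode (none (x , xs , xs⊆us , trans e′ e)))) _

    -- Where `f` takes an extreme value, the differences to the neighbours sum to zero, so
    -- extremality forces each of them to vanish. The point `m` is chosen once under `T`; the
    -- quantifier over `x` can stay inside because stability removes the `T` at each `x` separately.
    maximumPrinciple : {V : Set a} (neighbours : V → List V) (f : V → Carrier) (x₀ : V) (xs : List V) →
      (∀ x → T (Any (λ y → f x ≈ f y) (x₀ ∷ xs))) →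
      (∀ x → ∏ (λ y → f y - f x) (neighbours x) ≈ ε) →
      T (∃ λ m → ∀ x → f x ≈ f m → All (λ y → f y ≈ f m) (neighbours x))
    maximumPrinciple neighbours f x₀ xs values harmonic = do
      v , v∈ , extreme ← existsExtreme (f x₀) (map f xs)
      let m , v≈fm = Any.satisfied (map⁻ {f = f} {xs = x₀ ∷ xs} v∈)
      pure (m , λ x fx≈fm → All.tabulate λ y∈ → stable do
        ⊆values ← sequenceAll {xs = neighbours x} (All.universal (λ y → values y) (neighbours x))
        pure (trans (All.lookup (map⁻ᵃ (extreme (map f (neighbours x)) (map⁺ (All.map map⁺ₐ ⊆values))
          (trans (reflexive (∏-map (_- v) f (neighbours x)))
            (trans (∏-cong {xs = neighbours x} (All.universal (λ y → ∙-congˡ (⁻¹-cong (trans v≈fm (sym fx≈fm)))) _)) (harmonic x))))) y∈) v≈fm))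

  -- Rigidity of maps with prescribed stars.

  propagate : (G : Group c ℓ) → let open Group G in {S : List Carrier} → Generates G S →
    (Q : Carrier → Set r) → (∀ {x y} → x ≈ y → Q x → Q y) →
    (∀ x → Q x → All (λ s → Q (x ∙ s)) S) → ∀ x y → Q x → Q y
  propagate G {S} generates Q respects step x y Qx =
    let w , w⊆S , e = generates (x ⁻¹ ∙ y)
    in respects (trans (∙-congˡ (sym e)) (solve 2 (λ x y → x ⊕ ((x ⁻) ⊕ y) ⊜ y) refl x y)) (walk x w w⊆S Qx)
    where
    open Group G
    open GroupSolver G
    pick : ∀ {x s ss} → All (λ s → Q (x ∙ s)) ss → Any (s ≈_) ss → Q (x ∙ s)
    pick (h ∷ _)  (here e)  = respects (∙-congˡ (sym e)) h
    pick (_ ∷ hs) (there i) = pick hs i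
    walk : ∀ x w → All (λ s → Any (s ≈_) S) w → Q x → Q (x ∙ foldr _∙_ ε w)
    walk x [] [] h = respects (sym (identityʳ x)) h
    walk x (s ∷ w) (i ∷ is) h = respects (assoc _ _ _) (walk (x ∙ s) w is (pick (step x h) i))

  commutes-generators : (G : Group c ℓ) → let open Group G in {S : List Carrier} → Generates G S →
    ∀ {z} → (∀ {s} → Any (s ≈_) S → z ∙ s ≈ s ∙ z) → Central G z
  commutes-generators G {S} generates {z} h g =
    let w , w⊆S , e = generates g in trans (∙-congˡ e) (trans (go w w⊆S) (∙-congʳ (sym e)))
    where
    open Group G
    go : ∀ w → All (λ s → Any (s ≈_) S) w → z ∙ foldr _∙_ ε w ≈ foldr _∙_ ε w ∙ z
    go [] [] = trans (identityʳ z) (sym (identityˡ z))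
    go (s ∷ w) (i ∷ is) = trans (sym (assoc _ _ _)) (trans (∙-congʳ (h i)) (trans (assoc _ _ _)
      (trans (∙-congˡ (go w is)) (sym (assoc _ _ _)))))

  -- A permutation, unlike a bijection of sets, survives any coarser equality on `H`: generators
  -- that become equal still count separately.
  StarMap : (G : Group c₁ ℓ₁) (S : List (Group.Carrier G)) (H : Group c₂ ℓ₂) (L : List (Group.Carrier H)) →
            (Group.Carrier G → Group.Carrier H) → Set _
  StarMap G S H L f = ∀ x → T (map (λ s → f x ⁻¹ ∙ f (Group._∙_ G x s)) S ↭ L)
    where
    open Group H
    open import Data.List.Relation.Binary.Permutation.Setoid setoid using (_↭_)

  module _ (G : Group c₁ ℓ₁) (S : List (Group.Carrier G)) where

    open Group G using () renaming (Carrier to X; _∙_ to _·_; ε to x₀)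

    -- The star of `g` is the star of `f` conjugated by the constant `w`, so conjugation by `w` maps
    -- the finite list `L` to itself. Some positive power of `w` therefore commutes with a given
    -- generator, and by unique roots so does `w`.
    constant⇒central : (H : Group c₂ ℓ₂) → let open Group H in (L : List Carrier) →
      (∀ {x y} → Stable (x ≈ y)) → Powers.UniqueRoots H → Generates H L →
      (f g : X → Carrier) → StarMap G S H L f → StarMap G S H L g →
      (∀ x → f x ⁻¹ ∙ g x ≈ f x₀ ⁻¹ ∙ g x₀) → Central H (f x₀ ⁻¹ ∙ g x₀)
    constant⇒central H L stable roots generates f g star-f star-g const = commutes-generators H generates commutes
      where
      open Group H
      open GroupSolver H
      open Powers H
      open import Data.List.Membership.Setoid setoid using (_∈_)
      open import Data.List.Membership.Setoid.Properties using (∈-resp-≈)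
      open import Data.List.Relation.Binary.Permutation.Setoid setoid using (↭-sym)
      open import Data.List.Relation.Binary.Permutation.Setoid.Properties setoid using (∈-resp-↭)
      w = f x₀ ⁻¹ ∙ g x₀
      conj : ∀ {t} → t ∈ L → T (w ⁻¹ ∙ t ∙ w ∈ L)
      conj {t} t∈L = do
        p ← star-f x₀
        q ← star-g x₀
        pure (∈-resp-↭ q (map⁺ₐ (Any.map same (map⁻ (∈-resp-↭ (↭-sym p) t∈L)))))
        where
        same : ∀ {s} → t ≈ f x₀ ⁻¹ ∙ f (x₀ · s) → w ⁻¹ ∙ t ∙ w ≈ g x₀ ⁻¹ ∙ g (x₀ · s)
        same e = trans (∙-cong (∙-congˡ e) (sym (const _)))
          (solve 4 (λ f f′ g g′ → ((((f ⁻) ⊕ g) ⁻) ⊕ ((f ⁻) ⊕ f′)) ⊕ ((f′ ⁻) ⊕ g′) ⊜ (g ⁻) ⊕ g′) refl _ _ _ _)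
      orbit : ∀ i {t} → t ∈ L → T (pow H w i ⁻¹ ∙ t ∙ pow H w i ∈ L)
      orbit zero {t} t∈L = pure (∈-resp-≈ setoid (solve 1 (λ t → t ⊜ ((𝟙 ⁻) ⊕ t) ⊕ 𝟙) refl t) t∈L)
      orbit (suc i) {t} t∈L = conj t∈L >>= λ t′∈L → orbit i t′∈L >>= λ u∈L → pure (∈-resp-≈ setoid
        (solve 3 (λ t w p → ((p ⁻) ⊕ (((w ⁻) ⊕ t) ⊕ w)) ⊕ p ⊜ (((w ⊕ p) ⁻) ⊕ t) ⊕ (w ⊕ p)) refl t w _) u∈L)
      commutes : ∀ {t} → t ∈ L → w ∙ t ≈ t ∙ w
      commutes {t} t∈L = stable do
        i , n , e ← recurrence setoid L (λ i → pow H w i ⁻¹ ∙ t ∙ pow H w i) (λ i → orbit i t∈L)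
        let u = pow H w i
            v = pow H w (suc n)
            e′ : u ⁻¹ ∙ t ∙ u ≈ (v ∙ u) ⁻¹ ∙ t ∙ (v ∙ u)
            e′ = trans e (trans (reflexive (≡.cong (λ m → pow H w m ⁻¹ ∙ t ∙ pow H w m) (+-comm i (suc n))))
              (∙-cong (∙-congʳ (⁻¹-cong (pow-+ w (suc n) i))) (pow-+ w (suc n) i)))
        pure (uniqueRoots⇒isolated roots w t n (trans (solve 3 (λ t u v → v ⊕ t ⊜ ((v ⊕ u) ⊕ (((u ⁻) ⊕ t) ⊕ u)) ⊕ (u ⁻)) refl t u v)
          (trans (∙-congʳ (∙-congˡ e′)) (solve 3 (λ t u v → ((v ⊕ u) ⊕ ((((v ⊕ u) ⁻) ⊕ t) ⊕ (v ⊕ u))) ⊕ (u ⁻) ⊜ t ⊕ v) refl t u v))))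

    module _ (q : Level) where

      module _ (H : Group c (c ⊔ q)) where

        open Group H

        -- One step down the tower: if f⁻¹g is constant modulo the center, with value w, then the
        -- central factor α of f⁻¹g = w α is harmonic, because along an edge labelled t it changes
        -- by a translation of the star up to the commutator of t and w, and these commutators cancel
        -- over the symmetric list L.
        module RigidStep (L : List Carrier)
          (stable : ∀ {x y} → Stable (x ≈ y)) (torsionFree : TorsionFreeCenter H)
          (symmetric : Permutation.Permutation _≈_ (map _⁻¹ L) L)
          (f g : X → Carrier) (star-f : StarMap G S H L f) (star-g : StarMap G S H L g)
          (constant : ∀ x → Central H ((f x₀ ⁻¹ ∙ g x₀) ⁻¹ ∙ (f x ⁻¹ ∙ g x)))
          (central : ∀ t → Central H ((f x₀ ⁻¹ ∙ g x₀ ∙ t) ⁻¹ ∙ (t ∙ (f x₀ ⁻¹ ∙ g x₀)))) where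

          open GroupSolver H
          open AbelianGroup (centerGroup H) using () renaming (Carrier to Z; _≈_ to _≈ᶻ_; _∙_ to _∙ᶻ_; _-_ to _-ᶻ_; ε to εᶻ; setoid to setoidᶻ; group to groupᶻ)
          open Products (centerGroup H)
          open import Data.List.Relation.Binary.Permutation.Setoid setoid using (_↭_; ↭-sym; ↭-trans; ↭-reflexive)
          open import Data.List.Relation.Binary.Permutation.Setoid.Properties setoid using () renaming (map⁺ to map⁺↭)

          w : Carrier
          w = f x₀ ⁻¹ ∙ g x₀

          α : X → Z
          α x = w ⁻¹ ∙ (f x ⁻¹ ∙ g x) , constant x

          κ : Carrier → Z
          κ t = (w ∙ t) ⁻¹ ∙ (t ∙ w) , central t

          torsionFreeᶻ : TorsionFree groupᶻ
          torsionFreeᶻ z n e = torsionFree (proj₁ z) n (proj₂ z) (trans (reflexive (≡.sym (pow-center H z (suc n)))) e)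

          κ-cong : ∀ {s t} → s ≈ t → κ s ≈ᶻ κ t
          κ-cong e = ∙-cong (⁻¹-cong (∙-congˡ e)) (∙-congʳ e)

          κ-⁻¹ : ∀ t → proj₁ (κ (t ⁻¹)) ≈ proj₁ (κ t) ⁻¹
          κ-⁻¹ t = trans (solve 2 (λ t w → ((w ⊕ (t ⁻)) ⁻) ⊕ ((t ⁻) ⊕ w) ⊜ ((t ⊕ (((w ⊕ t) ⁻) ⊕ (t ⊕ w))) ⊕ (t ⁻)) ⁻) refl t w)
            (⁻¹-cong (central-conj H t (central t)))

          -- Inversion permutes `L` and inverts `κ`, so the product equals its own inverse. The
          -- argument 1 of torsion-freeness stands for the exponent two.
          ∏κ : ∏ κ L ≈ᶻ εᶻ
          ∏κ = torsionFreeᶻ (∏ κ L) 1 (trans (∙-congˡ (identityʳ _)) (trans (∙-congˡ (sym (∏-↭ (map⁺↭ setoidᶻ κ-cong symmetric))))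
            (trans (∙-congˡ (trans (reflexive (≡.cong proj₁ (∏-map κ _⁻¹ L))) (trans (∏-cong {f = κ ∘ _⁻¹} {xs = L} (All.universal κ-⁻¹ L)) (∏-⁻¹ κ L)))) (inverseʳ _))))

          harmonic : ∀ x → ∏ (λ y → α y -ᶻ α x) (map (x ·_) S) ≈ᶻ εᶻ
          harmonic x = stable (star-f x >>= λ p → star-g x >>= λ q → pure (harmonic′ p q))
            where
            τ : X → Carrier
            τ s = f x ⁻¹ ∙ f (x · s)
            δ : X → Z
            δ s = α (x · s) -ᶻ α x
            -- Conjugating `τ s` by `w` multiplies it by its `κ`, and the change of `α` along the
            -- edge contributes `δ s`. So the star of `g` is the star of `f` translated by these
            -- central elements, and both are permutations of `L`.
            pair : X → Carrier × Z
            pair s = τ s , (κ (τ s) ∙ᶻ δ s)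
            translate-pair : ∀ s → g x ⁻¹ ∙ g (x · s) ≈ translate H (pair s)
            translate-pair s = sym (trans (solve 4 (λ τ k a b → τ ⊕ (k ⊕ (a ⊕ (b ⁻))) ⊜ (τ ⊕ (k ⊕ a)) ⊕ (b ⁻)) refl _ _ _ _)
              (trans (sym (central-⁻¹ H (constant x) _)) (solve 5 (λ w f g f′ g′ →
                (((w ⁻) ⊕ ((f ⁻) ⊕ g)) ⁻) ⊕ (((f ⁻) ⊕ f′) ⊕ ((((w ⊕ ((f ⁻) ⊕ f′)) ⁻) ⊕ (((f ⁻) ⊕ f′) ⊕ w)) ⊕ ((w ⁻) ⊕ ((f′ ⁻) ⊕ g′))))
                ⊜ (g ⁻) ⊕ g′) refl w (f x) (g x) (f (x · s)) (g (x · s)))))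
            module _ (p : map τ S ↭ L) (q : map (λ s → g x ⁻¹ ∙ g (x · s)) S ↭ L) where
              permuted : map proj₁ (map pair S) ↭ map (translate H) (map pair S)
              permuted = ↭-trans (↭-reflexive (≡.sym (map-∘ S))) (↭-trans p (↭-trans (↭-sym q)
                (↭-trans (map-↭ setoid translate-pair S) (↭-reflexive (map-∘ S)))))
              ∏κτ : ∏ (κ ∘ τ) S ≈ᶻ εᶻ
              ∏κτ = trans (reflexive (≡.cong proj₁ (≡.sym (∏-map κ τ S)))) (trans (∏-↭ (map⁺↭ setoidᶻ κ-cong p)) ∏κ)
              harmonic′ : ∏ (λ y → α y -ᶻ α x) (map (x ·_) S) ≈ᶻ εᶻ
              harmonic′ = trans (reflexive (≡.cong proj₁ (∏-map (λ y → α y -ᶻ α x) (x ·_) S)))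
                (trans (sym (identityˡ _)) (trans (∙-congʳ (sym ∏κτ)) (trans (sym (∏-∙ (κ ∘ τ) δ S))
                (trans (reflexive (≡.cong proj₁ (≡.sym (∏-map proj₂ pair S)))) (translation-total H (map pair S) permuted)))))

          step : (∀ {x y} → Group._≈_ G x y → f x ≈ f y) → (∀ {x y} → Group._≈_ G x y → g x ≈ g y) → Generates G S →
            (xs : List X) → (∀ x → T (Any (λ y → f x ⁻¹ ∙ g x ≈ f y ⁻¹ ∙ g y) (x₀ ∷ xs))) →
            ∀ x → f x ⁻¹ ∙ g x ≈ w
          step f-cong g-cong generates xs values x = stable do
            m , h ← Extreme.maximumPrinciple (centerGroup H) stable torsionFreeᶻ (λ x → map (x ·_) S) α x₀ xs
              (λ x k → values x (k ∘ Any.map ∙-congˡ)) harmonic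
            let at : ∀ x → proj₁ (α x) ≈ proj₁ (α m)
                at x = propagate G generates (λ x → proj₁ (α x) ≈ proj₁ (α m))
                  (λ e → trans (∙-congˡ (∙-cong (⁻¹-cong (f-cong (Group.sym G e))) (g-cong (Group.sym G e)))))
                  (λ x e → map⁻ᵃ (h x e)) m x refl
            pure (∙-cancelˡ (w ⁻¹) _ _ (trans (at x) (sym (at x₀))))
            where open import Algebra.Properties.Group H

      -- Constancy modulo the center is the same statement for the quotient, with the same lists.
      -- There `constant⇒central` makes the constant central, which says exactly that its
      -- commutators in `H` are central, as `RigidStep` demands.
      rigid : ∀ k (H : Group c (c ⊔ q)) → let open Group H in (L : List Carrier) →
        (∀ {x y} → Stable (x ≈ y)) → CentralTower q k H →
        Permutation.Permutation _≈_ (map _⁻¹ L) L →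
        Generates H L → Generates G S →
        (f g : X → Carrier) → (∀ {x y} → Group._≈_ G x y → f x ≈ f y) → (∀ {x y} → Group._≈_ G x y → g x ≈ g y) →
        StarMap G S H L f → StarMap G S H L g →
        (xs : List X) → (∀ x → T (Any (λ y → f x ⁻¹ ∙ g x ≈ f y ⁻¹ ∙ g y) (x₀ ∷ xs))) →
        ∀ x → f x ⁻¹ ∙ g x ≈ f x₀ ⁻¹ ∙ g x₀
      rigid zero H L stable tower symmetric generates-H generates-G f g f-cong g-cong star-f star-g xs values x =
        trans (tower _) (sym (tower _))
        where open Group H
      rigid (suc k) H L stable (tf , tower) symmetric generates-H generates-G f g f-cong g-cong star-f star-g xs values =
        RigidStep.step H L stable tf symmetric f g star-f star-g (λ x → Quot.~-sym H (center q H) (constant x))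
          (constant⇒central H/Z L stable/ (tower⇒uniqueRoots q k H/Z tower) generates/ f g star-f/ star-g/ constant)
          f-cong g-cong generates-G xs values
        where
        open Group H
        open Quot H (center q H) using (≈⇒~)
        H/Z = H / center q H
        stable/ : ∀ {x y} → Stable (Group._≈_ H/Z x y)
        stable/ m g = stable λ k → m λ h → k (h g)
        generates/ : Generates H/Z L
        generates/ x = let w , w⊆L , e = generates-H x in w , All.map (Any.map ≈⇒~) w⊆L , ≈⇒~ e
        star-f/ : StarMap G S H/Z L f
        star-f/ x k = star-f x (k ∘ Permutation.map ≈⇒~)
        star-g/ : StarMap G S H/Z L g
        star-g/ x k = star-g x (k ∘ Permutation.map ≈⇒~)
        constant : ∀ x → Group._≈_ H/Z (f x ⁻¹ ∙ g x) (f x₀ ⁻¹ ∙ g x₀)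
        constant = rigid k H/Z L stable/ tower (Permutation.map ≈⇒~ symmetric) generates/ generates-G f g
          (≈⇒~ ∘ f-cong) (≈⇒~ ∘ g-cong) star-f/ star-g/ xs (λ x k → values x (k ∘ Any.map ≈⇒~))

  -- The maximum principle wants finitely many points at which all values occur, while word length
  -- only bounds the possible values. Classically each possible value is either attained, giving a
  -- point, or discarded.
  representatives : {X : Set a} (G : Setoid c ℓ) → let open Setoid G in (f : X → Carrier) (L : List Carrier) →
    T (∃ λ xs → ∀ x → Any (f x ≈_) L → T (Any (λ y → f x ≈ f y) xs))
  representatives G f [] = pure ([] , λ x ())
  representatives G f (v ∷ L) = do
    xs , h ← representatives G f L
    em (∃ λ y → f y ≈ v) >>= λ where
      (inj₁ (y , fy≈v)) → pure (y ∷ xs , λ { x (here e) → pure (here (trans e (sym fy≈v)))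
                                           ; x (there i) → h x i >>= λ j → pure (there j) })
      (inj₂ none) → pure (xs , λ { x (here e) → explode (none (x , e)) ; x (there i) → h x i })
    where open Setoid G

  -- Displacements under left translations.

  module Displacement (G₁ : Group c₁ ℓ₁) (G₂ : Group c₂ ℓ₂)
    (S₁ : List (Group.Carrier G₁)) (S₂ : List (Group.Carrier G₂))
    (generates₁ : Generates G₁ S₁) (symmetric₂ : SymmetricSet G₂ S₂) (generates₂ : Generates G₂ S₂)
    (q : Level) (C : Coarsening G₂ (c₂ ⊔ q)) (stable : ∀ {x y} → Stable (Coarsening._≈′_ C x y))
    (k : ℕ) (tower : CentralTower q k (coarse C)) where

    open Group G₁ using () renaming (Carrier to X₁; _≈_ to _≈₁_; _∙_ to _∙₁_; ε to ε₁; _⁻¹ to _⁻¹₁)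
    open Group G₂ using () renaming (Carrier to X₂; _≈_ to _≈₂_; _∙_ to _∙₂_; ε to ε₂; _⁻¹ to _⁻¹₂)
    open Coarsening C using (_≈′_; ≈⇒≈′; generates-coarse)
    private
      module G₁ = Group G₁
      module G₂ = Group G₂
      module H = Group (coarse C)
    open CayleyIso G₁ G₂
    open Data.List.Membership.Setoid.Properties using (∈-resp-≈)

    star-↭ : ∀ {S₁ S₂ φ} → Distinct G₁.setoid S₁ → Distinct G₂.setoid S₂ → IsCayleyIso G₁ S₁ G₂ S₂ φ →
      ∀ x → T (Permutation.Permutation _≈₂_ (map (λ s → φ x ⁻¹₂ ∙₂ φ (x ∙₁ s)) S₁) S₂)
    star-↭ {S₁} {S₂} {φ} distinct₁ distinct₂ iso x = distinct⇒↭ G₂.setoid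
        (AllPairs.map⁺ (AllPairs.map (λ s≉t e → s≉t (∙-cancelˡ₁ x _ _ (injective (∙-cancelˡ₂ _ _ _ e)))) distinct₁)) distinct₂
        (λ i → pure (⊆-trans G₂.setoid {xs = map (λ s → φ x ⁻¹₂ ∙₂ φ (x ∙₁ s)) S₁} (map⁺ (All.tabulateₛ G₁.setoid λ s∈S₁ →
          CayleyGraph.adj⇒∈ G₂ (adj⇒ _ _ (CayleyGraph.∈⇒adj G₁ s∈S₁)))) i))
        (λ {z} i → pure (map⁺ₐ (Any.map (λ e → G₂.trans
            (G₂.sym (\\-leftDividesʳ (φ x) z))
            (G₂.∙-congˡ (G₂.trans (G₂.sym (φφ⁻¹ iso _)) (cong e))))
          (adj⇐ _ _ (CayleyGraph.adj-resp G₂ G₂.refl (G₂.sym (φφ⁻¹ iso (φ x ∙₂ z))) (CayleyGraph.∈⇒adj G₂ i))))))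
      where
      open IsCayleyIso iso
      open import Algebra.Properties.Group G₁ using () renaming (∙-cancelˡ to ∙-cancelˡ₁)
      open import Algebra.Properties.Group G₂ using (\\-leftDividesʳ) renaming (∙-cancelˡ to ∙-cancelˡ₂)

    inverse-↭ : ∀ {S} → Distinct G₂.setoid S → SymmetricSet G₂ S → T (Permutation.Permutation _≈₂_ (map _⁻¹₂ S) S)
    inverse-↭ {S} distinct symmetric = distinct⇒↭ G₂.setoid
      (AllPairs.map⁺ (AllPairs.map (λ s≉t e → s≉t (⁻¹-injective e)) distinct)) distinct
      (λ i → pure (⊆-trans G₂.setoid (map⁺ symmetric) i))
      (λ i → pure (map⁺ₐ (Any.map (λ e → G₂.trans (G₂.sym (⁻¹-involutive _)) (G₂.⁻¹-cong e)) (CayleyGraph.⁻¹-∈ G₂ symmetric i))))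
      where open import Algebra.Properties.Group G₂

    constantDisplacement : ∀ {φ ψ} → IsCayleyIso G₁ S₁ G₂ S₂ φ → IsCayleyIso G₁ S₁ G₂ S₂ ψ →
      (xs : List X₁) → (∀ x → T (Any (λ y → (φ x ⁻¹₂ ∙₂ ψ x) ≈′ (φ y ⁻¹₂ ∙₂ ψ y)) (ε₁ ∷ xs))) →
      T ((∀ x → (φ x ⁻¹₂ ∙₂ ψ x) ≈′ (φ ε₁ ⁻¹₂ ∙₂ ψ ε₁)) × Central (coarse C) (φ ε₁ ⁻¹₂ ∙₂ ψ ε₁))
    constantDisplacement {φ} {ψ} isoφ isoψ xs values = do
      S₁′ , distinct₁ , S₁′⊆S₁ , S₁⊆S₁′ ← deduplicate G₁.setoid S₁
      S₂′ , distinct₂ , S₂′⊆S₂ , S₂⊆S₂′ ← deduplicate G₂.setoid S₂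
      symmetric ← inverse-↭ distinct₂ (CayleyGraph.symmetric-mono G₂ S₂⊆S₂′ S₂′⊆S₂ symmetric₂)
      let generates₁′ = CayleyGraph.generates-mono G₁ S₁⊆S₁′ generates₁
          generates₂′ = generates-coarse (CayleyGraph.generates-mono G₂ S₂⊆S₂′ generates₂)
          star : ∀ {φ} → IsCayleyIso G₁ S₁ G₂ S₂ φ → StarMap G₁ S₁′ (coarse C) S₂′ φ
          star iso x = star-↭ distinct₁ distinct₂ (iso-mono iso S₁′⊆S₁ S₁⊆S₁′ S₂′⊆S₂ S₂⊆S₂′) x >>= λ r → pure (Permutation.map ≈⇒≈′ r)
          constant = rigid G₁ S₁′ q k (coarse C) S₂′ stable tower (Permutation.map ≈⇒≈′ symmetric) generates₂′ generates₁′
            φ ψ (≈⇒≈′ ∘ IsCayleyIso.cong isoφ) (≈⇒≈′ ∘ IsCayleyIso.cong isoψ) (star isoφ) (star isoψ) xs values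
      pure (constant , constant⇒central G₁ S₁′ (coarse C) S₂′ stable (tower⇒uniqueRoots q k (coarse C) tower) generates₂′
        φ ψ (star isoφ) (star isoψ) constant)

    -- Left translation by `z` moves `x` by its conjugate on the right. Finitely many conjugates
    -- therefore give bounded word length, hence finitely many displacements of the images.
    translationDisplacement : ∀ {φ} → IsCayleyIso G₁ S₁ G₂ S₂ φ → ∀ z (conjugates : List X₁) →
      (∀ x → T (_∈ₗ_ G₁ (x ⁻¹₁ ∙₁ (z ∙₁ x)) conjugates)) →
      T ((∀ x → (φ x ⁻¹₂ ∙₂ φ (z ∙₁ x)) ≈′ (φ ε₁ ⁻¹₂ ∙₂ φ (z ∙₁ ε₁))) × Central (coarse C) (φ ε₁ ⁻¹₂ ∙₂ φ (z ∙₁ ε₁)))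
    translationDisplacement {φ} iso z conjugates finite = do
      xs , h ← representatives G₂.setoid (λ x → φ x ⁻¹₂ ∙₂ φ (z ∙₁ x)) (concatMap (λ u → CayleyGraph.words G₂ S₂ (length (proj₁ (generates₁ u)))) conjugates)
      constantDisplacement iso (iso-translate iso z) xs λ x →
        finite x >>= λ i → h x (concatMap⁺ _ (Any.map (bounded x) i)) >>= λ j → pure (there (Any.map ≈⇒≈′ j))
      where
      bounded : ∀ x {u} → (x ⁻¹₁ ∙₁ (z ∙₁ x)) ≈₁ u →
        _∈ₗ_ G₂ (φ x ⁻¹₂ ∙₂ φ (z ∙₁ x)) (CayleyGraph.words G₂ S₂ (length (proj₁ (generates₁ u))))
      bounded x {u} e = let w , w⊆S₁ , e′ = generates₁ u in
        ∈-resp-≈ G₂.setoid (G₂.∙-congˡ (IsCayleyIso.cong iso (G₁.trans (G₁.∙-congˡ (G₁.sym (G₁.trans e e′))) (\\-leftDividesˡ x (z ∙₁ x)))))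
          (displacement-∈-words iso w w⊆S₁ x)
        where open import Algebra.Properties.Group G₁ using (\\-leftDividesˡ)

    -- A finite normal subgroup consists of torsion elements, and so do the displacements
    -- of translations by its elements.
    finiteNormal-invisible : (N : NormalSubgroup G₁) → FiniteNormal G₁ N → ∀ {φ} → IsCayleyIso G₁ S₁ G₂ S₂ φ →
      ∀ {z} → NormalSubgroup.member N z → ∀ x → φ (z ∙₁ x) ≈′ φ x
    finiteNormal-invisible N (ns , N⊆ns) {φ} iso {z} z∈N x = stable do
      constant , central ← translationDisplacement iso z ns λ x → pure (N⊆ns _ (resp∈ (conj-eq x) (conj∈ (x ⁻¹₁) z∈N)))
      i , n , e ← recurrence G₁.setoid ns (pow G₁ z) λ i → pure (N⊆ns _ (pow-∈ i))
      let w = φ ε₁ ⁻¹₂ ∙₂ φ (z ∙₁ ε₁)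
          shift : ∀ x → φ (z ∙₁ x) ≈′ (φ x ∙₂ w)
          shift x = H.trans (H.sym (\\-leftDividesˡ (φ x) _)) (H.∙-congˡ (constant x))
          shifts : ∀ m → φ (pow G₁ z m ∙₁ x) ≈′ (φ x ∙₂ pow (coarse C) w m)
          shifts = λ m → ℕ-rec (λ m → φ (pow G₁ z m ∙₁ x) ≈′ (φ x ∙₂ pow (coarse C) w m))
            (H.trans (≈⇒≈′ (cong (G₁.identityˡ x))) (H.sym (H.identityʳ _)))
            (λ m e → H.trans (≈⇒≈′ (cong (G₁.assoc _ _ _))) (H.trans (shift _) (H.trans (H.∙-congʳ e)
              (H.trans (H.assoc _ _ _) (H.∙-congˡ (H.sym (central _))))))) m
          zⁿ : pow G₁ z (suc n) ≈₁ ε₁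
          zⁿ = G₁.sym (∙-cancelˡ₁ (pow G₁ z i) _ _ (G₁.trans (G₁.identityʳ _) (G₁.trans e (Powers.pow-+ G₁ z i (suc n)))))
          wⁿ : pow (coarse C) w (suc n) ≈′ ε₂
          wⁿ = ∙-cancelˡ₂ (φ x) _ _ (H.trans (H.sym (shifts (suc n))) (H.trans (≈⇒≈′ (cong (G₁.trans (G₁.∙-congʳ zⁿ) (G₁.identityˡ x)))) (H.sym (H.identityʳ _))))
      pure (H.trans (shift x) (H.trans (H.∙-congˡ (Powers.uniqueRoots⇒torsionFree (coarse C) (tower⇒uniqueRoots q k (coarse C) tower) w n wⁿ)) (H.identityʳ _)))
      where
      open NormalSubgroup N
      open IsCayleyIso iso
      open import Algebra.Properties.Group G₁ using (⁻¹-involutive) renaming (∙-cancelˡ to ∙-cancelˡ₁)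
      open import Algebra.Properties.Group (coarse C) using (\\-leftDividesˡ) renaming (∙-cancelˡ to ∙-cancelˡ₂)
      conj-eq : ∀ x → (x ⁻¹₁ ∙₁ z ∙₁ x ⁻¹₁ ⁻¹₁) ≈₁ (x ⁻¹₁ ∙₁ (z ∙₁ x))
      conj-eq x = G₁.trans (G₁.assoc _ _ _) (G₁.∙-congˡ (G₁.∙-congˡ (⁻¹-involutive x)))
      pow-∈ : ∀ i → member (pow G₁ z i)
      pow-∈ zero    = ε∈
      pow-∈ (suc i) = ∙∈ z∈N (pow-∈ i)
      ℕ-rec : (Q : ℕ → Set r) → Q 0 → (∀ n → Q n → Q (suc n)) → ∀ n → Q n
      ℕ-rec Q q₀ step zero    = q₀
      ℕ-rec Q q₀ step (suc n) = step n (ℕ-rec Q q₀ step n)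

    -- Passing from `x` to `y` by right multiplication with an element of `N` is left translation by
    -- a conjugate of that element, which again lies in `N`.
    cosets-collapse : (N : NormalSubgroup G₁) → FiniteNormal G₁ N → ∀ {φ} → IsCayleyIso G₁ S₁ G₂ S₂ φ →
      ∀ {x y} → NormalSubgroup.member N (x ⁻¹₁ ∙₁ y) → φ x ≈′ φ y
    cosets-collapse N finite iso {x} {y} x~y = H.sym (H.trans
      (≈⇒≈′ (IsCayleyIso.cong iso (solve 2 (λ x y → y ⊜ ((x ⊕ ((x ⁻) ⊕ y)) ⊕ (x ⁻)) ⊕ x) G₁.refl x y)))
      (finiteNormal-invisible N finite iso (NormalSubgroup.conj∈ N x x~y) x))
      where open GroupSolver G₁

  -- Affinity by induction over quotients by the centers.

  module _ (H₁ : Group c₁ ℓ₁) (H₂ : Group c₂ ℓ₂) where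

    open Group H₁ using () renaming (Carrier to X₁; _≈_ to _≈₁_; _∙_ to _∙₁_; ε to ε₁; _⁻¹ to _⁻¹₁)
    open Group H₂

    -- The defect γ of affinity is central and constant on cosets of the center. Hence
    -- multiplication by δ = γ (y s) (γ y)⁻¹ carries t = (φ y)⁻¹ φ (y s) to another element of S₂
    -- of the same form, with s replaced by an element of the same coset of the center. Iterating,
    -- all t δⁱ lie in the finite set S₂, so δ is torsion.
    module AffineStep
      (S₁ : List X₁) (S₂ : List Carrier) (generates₁ : Generates H₁ S₁)
      (stable : ∀ {x y} → Stable (x ≈ y)) (torsionFree : TorsionFreeCenter H₂)
      (φ : X₁ → Carrier) (iso : IsCayleyIso H₁ S₁ H₂ S₂ φ)
      (translation : ∀ {z} → Central H₁ z → (∀ x → φ x ⁻¹ ∙ φ (z ∙₁ x) ≈ φ ε₁ ⁻¹ ∙ φ (z ∙₁ ε₁)) × Central H₂ (φ ε₁ ⁻¹ ∙ φ (z ∙₁ ε₁)))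
      (injective/ : ∀ {x y} → Central H₂ (φ x ⁻¹ ∙ φ y) → Central H₁ (x ⁻¹₁ ∙₁ y))
      (affine/ : ∀ x y → Central H₂ ((φ x ∙ (φ ε₁ ⁻¹ ∙ φ y)) ⁻¹ ∙ φ (x ∙₁ y))) (x : X₁) where

      private module H₁ = Group H₁
      open IsCayleyIso iso
      open CayleyIso H₁ H₂
      open GroupSolver H₂
      open Powers H₂
      open Algebra.Properties.Group H₂ using (\\-leftDividesˡ; ∙-cancelˡ)
      module P₁ = Algebra.Properties.Group H₁
      module Cay₁ = CayleyGraph H₁
      module Cay₂ = CayleyGraph H₂
      open Data.List.Membership.Setoid.Properties using (∈-resp-≈)

      γ : X₁ → Carrier
      γ y = (φ x ∙ (φ ε₁ ⁻¹ ∙ φ y)) ⁻¹ ∙ φ (x ∙₁ y)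

      γ-cong : ∀ {y y′} → y ≈₁ y′ → γ y ≈ γ y′
      γ-cong e = ∙-cong (⁻¹-cong (∙-congˡ (∙-congˡ (cong e)))) (cong (H₁.∙-congˡ e))

      -- Moving `y` by a central element multiplies `φ y` and `φ (x ∙₁ y)` on the right by the same
      -- `w`, which cancels because the defect is central.
      γ-periodic : ∀ {y y′} → Central H₁ (y ⁻¹₁ ∙₁ y′) → γ y′ ≈ γ y
      γ-periodic {y} {y′} z-central = trans (∙-cong (⁻¹-cong (∙-congˡ (∙-congˡ φy′))) φxy′)
          (trans (solve 5 (λ a b c d w → ((a ⊕ ((b ⁻) ⊕ (c ⊕ w))) ⁻) ⊕ (d ⊕ w) ⊜ (w ⁻) ⊕ ((((a ⊕ ((b ⁻) ⊕ c)) ⁻) ⊕ d) ⊕ w)) refl (φ x) (φ ε₁) (φ y) (φ (x ∙₁ y)) w)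
            (trans (∙-congˡ (affine/ x y w)) (solve 2 (λ w g → (w ⁻) ⊕ (w ⊕ g) ⊜ g) refl w (γ y))))
        where
        z = y ⁻¹₁ ∙₁ y′
        w = φ ε₁ ⁻¹ ∙ φ (z ∙₁ ε₁)
        shift : ∀ u → φ (z ∙₁ u) ≈ φ u ∙ w
        shift u = trans (sym (\\-leftDividesˡ (φ u) _)) (∙-congˡ (proj₁ (translation z-central) u))
        y′≈ : y′ ≈₁ y ∙₁ z
        y′≈ = H₁.sym (P₁.\\-leftDividesˡ y y′)
        φy′ : φ y′ ≈ φ y ∙ w
        φy′ = trans (cong (H₁.trans y′≈ (H₁.sym (z-central y)))) (shift y)
        φxy′ : φ (x ∙₁ y′) ≈ φ (x ∙₁ y) ∙ w
        φxy′ = trans (cong (H₁.trans (H₁.∙-congˡ y′≈) (H₁.trans (H₁.sym (H₁.assoc _ _ _)) (H₁.sym (z-central _))))) (shift _)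

      module _ (y s : X₁) (s∈S₁ : _∈ₗ_ H₁ s S₁) where

        δ t : Carrier
        δ = γ (y ∙₁ s) ∙ γ y ⁻¹
        t = φ y ⁻¹ ∙ φ (y ∙₁ s)

        δ-central : Central H₂ δ
        δ-central = central-∙ H₂ (affine/ x (y ∙₁ s)) (central-⁻¹ H₂ (affine/ x y))

        orbit : ∀ i → ∃ λ sᵢ → _∈ₗ_ H₁ sᵢ S₁ × Central H₁ ((y ∙₁ s) ⁻¹₁ ∙₁ (y ∙₁ sᵢ)) × φ y ⁻¹ ∙ φ (y ∙₁ sᵢ) ≈ t ∙ pow H₂ δ i
        orbit zero = s , s∈S₁ , central-resp H₁ (H₁.sym (H₁.inverseˡ _)) (central-ε H₁) , sym (identityʳ t)
        orbit (suc i) =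
          let u , u∈S₁ , u~s , φu = orbit i
              τ = φ (x ∙₁ y) ⁻¹ ∙ φ (x ∙₁ (y ∙₁ u))
              τ∈S₂ : _∈ₗ_ H₂ τ S₂
              τ∈S₂ = ∈-resp-≈ setoid (∙-congˡ (cong (H₁.assoc _ _ _))) (Cay₂.adj⇒∈ (adj⇒ _ _ (Cay₁.∈⇒adj {g = x ∙₁ y} u∈S₁)))
              τ≈ : τ ≈ φ y ⁻¹ ∙ φ (y ∙₁ u) ∙ δ
              τ≈ = trans (solve 6 (λ a b c d c′ d′ →
                       (d ⁻) ⊕ d′ ⊜ ((((a ⊕ ((b ⁻) ⊕ c)) ⁻) ⊕ d) ⁻) ⊕ (((c ⁻) ⊕ c′) ⊕ (((a ⊕ ((b ⁻) ⊕ c′)) ⁻) ⊕ d′)))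
                     refl (φ x) (φ ε₁) (φ y) (φ (x ∙₁ y)) (φ (y ∙₁ u)) (φ (x ∙₁ (y ∙₁ u))))
                   (trans (central-⁻¹ H₂ (affine/ x y) _) (trans (assoc _ _ _) (∙-congˡ (∙-congʳ (γ-periodic u~s)))))
              -- Since `τ` lies in `S₂`, it also labels an edge at `φ y`; pulling this edge back
              -- gives the next generator. Its coset is unchanged, as `δ` is central and `φ` is
              -- injective modulo the centers.
              v = φ⁻¹ iso (φ y ∙ τ)
              u′ = y ⁻¹₁ ∙₁ v
              φv : φ (y ∙₁ u′) ≈ φ y ∙ τ
              φv = trans (cong (P₁.\\-leftDividesˡ y v)) (φφ⁻¹ iso _)
              u′∈S₁ : _∈ₗ_ H₁ u′ S₁
              u′∈S₁ = Cay₁.adj⇒∈ (adj⇐ y v (Cay₂.adj-resp refl (sym (φφ⁻¹ iso _)) (Cay₂.∈⇒adj τ∈S₂)))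
              u′~u : Central H₁ ((y ∙₁ u) ⁻¹₁ ∙₁ (y ∙₁ u′))
              u′~u = injective/ (central-resp H₂ (sym (trans (∙-congˡ (trans φv (∙-congˡ τ≈)))
                (solve 3 (λ a b d → (b ⁻) ⊕ (a ⊕ (((a ⁻) ⊕ b) ⊕ d)) ⊜ d) refl _ _ _))) δ-central)
          in u′ , u′∈S₁ , central-resp H₁ (solve₁ 3 (λ a b c → ((a ⁻₁) ⊕₁ b) ⊕₁ ((b ⁻₁) ⊕₁ c) ⊜₁ (a ⁻₁) ⊕₁ c) H₁.refl _ _ _) (central-∙ H₁ u~s u′~u) ,
             trans (∙-congˡ φv) (trans (solve 2 (λ a b → (a ⁻) ⊕ (a ⊕ b) ⊜ b) refl _ _)
               (trans τ≈ (trans (∙-congʳ φu) (trans (assoc _ _ _) (∙-congˡ (sym (δ-central _)))))))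
          where open GroupSolver H₁ using () renaming (solve to solve₁; _⊕_ to _⊕₁_; _⁻ to _⁻₁; _⊜_ to _⊜₁_)

        δ≈ε : δ ≈ ε
        δ≈ε = stable do
          i , n , e ← recurrence setoid S₂ (λ i → t ∙ pow H₂ δ i) λ i → let u , u∈S₁ , _ , e = orbit i in
            pure (∈-resp-≈ setoid e (Cay₂.adj⇒∈ (adj⇒ _ _ (Cay₁.∈⇒adj u∈S₁))))
          pure (torsionFree δ n δ-central (sym (∙-cancelˡ (pow H₂ δ i) _ _
            (trans (identityʳ _) (trans (∙-cancelˡ t _ _ e) (pow-+ δ i (suc n)))))))

        γ-edge : γ (y ∙₁ s) ≈ γ y
        γ-edge = trans (solve 2 (λ a b → a ⊜ (a ⊕ (b ⁻)) ⊕ b) refl _ _) (trans (∙-congʳ δ≈ε) (identityˡ _))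

      affine : ∀ y → φ (x ∙₁ y) ≈ φ x ∙ (φ ε₁ ⁻¹ ∙ φ y)
      affine y = trans (sym (\\-leftDividesˡ _ _)) (trans (∙-congˡ γ≈ε) (identityʳ _))
        where
        γ≈ε : γ y ≈ ε
        γ≈ε = propagate H₁ generates₁ (λ y → γ y ≈ ε) (λ e → trans (γ-cong (H₁.sym e)))
          (λ y e → All.tabulateₛ H₁.setoid λ {s} s∈S₁ → trans (γ-edge y s s∈S₁) e) ε₁ y
          (trans (∙-congˡ (cong (H₁.identityʳ x))) (solve 2 (λ a b → ((a ⊕ ((b ⁻) ⊕ b)) ⁻) ⊕ a ⊜ 𝟙) refl _ _))

  module CentralTranslation (H₁ : Group c₁ ℓ₁) (q : Level) (H₂ : Group c₂ (c₂ ⊔ q))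
    (stable : ∀ {x y} → Stable (Group._≈_ H₂ x y)) (k : ℕ) (tower : CentralTower q k H₂)
    {S₁ : List (Group.Carrier H₁)} {S₂ : List (Group.Carrier H₂)}
    (generates₁ : Generates H₁ S₁) (symmetric₂ : SymmetricSet H₂ S₂) (generates₂ : Generates H₂ S₂)
    {φ : Group.Carrier H₁ → Group.Carrier H₂} (iso : IsCayleyIso H₁ S₁ H₂ S₂ φ) where

    open Group H₁ using () renaming (_∙_ to _∙₁_; ε to ε₁; _⁻¹ to _⁻¹₁)
    open Group H₂

    translation : ∀ {z} → Central H₁ z → (∀ x → φ x ⁻¹ ∙ φ (z ∙₁ x) ≈ φ ε₁ ⁻¹ ∙ φ (z ∙₁ ε₁)) × Central H₂ (φ ε₁ ⁻¹ ∙ φ (z ∙₁ ε₁))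
    translation {z} z-central = (λ x → stable (displacement >>= λ h → pure (proj₁ h x))) , λ g → stable (displacement >>= λ h → pure (proj₂ h g))
      where
      open Displacement H₁ H₂ S₁ S₂ generates₁ symmetric₂ generates₂ q (trivial H₂) stable k tower
      -- A central element is its only conjugate, so a single entry bounds all displacements.
      displacement = translationDisplacement iso z (z ∷ []) λ x →
        pure (here (Group.trans H₁ (Group.∙-congˡ H₁ (z-central x)) (Algebra.Properties.Group.\\-leftDividesʳ H₁ x z)))

    cong-center : ∀ {x y} → Central H₁ (x ⁻¹₁ ∙₁ y) → Central H₂ (φ x ⁻¹ ∙ φ y)
    cong-center {x} {y} z-central = central-resp H₂ (trans (sym (proj₁ (translation z-central) x)) (∙-congˡ (IsCayleyIso.cong iso
      (Group.trans H₁ (z-central x) (Algebra.Properties.Group.\\-leftDividesˡ H₁ x y))))) (proj₂ (translation z-central))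

  -- Central translations, applied to `φ` and to its inverse, let `φ` descend to an isomorphism of
  -- the quotient graphs, whose affinity is the input of `AffineStep`. The two heights may differ:
  -- as soon as one is zero, that group is trivial and both sides agree.
  affine : ∀ q₁ q₂ k₁ k₂ (H₁ : Group c₁ (c₁ ⊔ q₁)) (H₂ : Group c₂ (c₂ ⊔ q₂)) →
    let open Group H₁ using () renaming (Carrier to X₁; _≈_ to _≈₁_; _∙_ to _∙₁_; ε to ε₁; _⁻¹ to _⁻¹₁)
        open Group H₂ in
    (∀ {x y} → Stable (x ≈₁ y)) → (∀ {x y} → Stable (x ≈ y)) → CentralTower q₁ k₁ H₁ → CentralTower q₂ k₂ H₂ →
    ∀ S₁ S₂ → SymmetricSet H₁ S₁ → Generates H₁ S₁ → SymmetricSet H₂ S₂ → Generates H₂ S₂ →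
    ∀ φ → IsCayleyIso H₁ S₁ H₂ S₂ φ → ∀ x y → φ (x ∙₁ y) ≈ φ x ∙ (φ ε₁ ⁻¹ ∙ φ y)
  affine q₁ q₂ zero k₂ H₁ H₂ stable₁ stable₂ tower₁ tower₂ S₁ S₂ symmetric₁ generates₁ symmetric₂ generates₂ φ iso x y =
    trans (cong (H₁.trans (tower₁ _) (H₁.sym (tower₁ x)))) (sym (trans (∙-congˡ (trans (∙-congˡ (cong (tower₁ y))) (inverseˡ _))) (identityʳ _)))
    where
    open Group H₂
    module H₁ = Group H₁
    open IsCayleyIso iso
  affine q₁ q₂ (suc k₁) zero H₁ H₂ stable₁ stable₂ tower₁ tower₂ S₁ S₂ symmetric₁ generates₁ symmetric₂ generates₂ φ iso x y =
    Group.trans H₂ (tower₂ _) (Group.sym H₂ (tower₂ _))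
  affine q₁ q₂ (suc k₁) (suc k₂) H₁ H₂ stable₁ stable₂ tower₁ tower₂ S₁ S₂ symmetric₁ generates₁ symmetric₂ generates₂ φ iso x y =
    AffineStep.affine H₁ H₂ S₁ S₂ generates₁ stable₂ (proj₁ tower₂) φ iso
      T₁₂.translation injective/
      (λ x y → Quot.~-sym H₂ (center q₂ H₂) (affine q₁ q₂ k₁ k₂ H₁/Z H₂/Z (stable/ q₁ H₁ stable₁) (stable/ q₂ H₂ stable₂) (proj₂ tower₁) (proj₂ tower₂) S₁ S₂
        (Coarsening.symmetric-coarse C₁ symmetric₁) (Coarsening.generates-coarse C₁ generates₁)
        (Coarsening.symmetric-coarse C₂ symmetric₂) (Coarsening.generates-coarse C₂ generates₂) φ iso/ x y)) x y
    where
    module T₁₂ = CentralTranslation H₁ q₂ H₂ stable₂ (suc k₂) tower₂ generates₁ symmetric₂ generates₂ iso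
    module T₂₁ = CentralTranslation H₂ q₁ H₁ stable₁ (suc k₁) tower₁ generates₂ symmetric₁ generates₁ (CayleyIso.inverse H₁ H₂ iso)
    H₁/Z = H₁ / center q₁ H₁
    H₂/Z = H₂ / center q₂ H₂
    C₁ = quotient H₁ (center q₁ H₁)
    C₂ = quotient H₂ (center q₂ H₂)
    stable/ : ∀ {c} q (H : Group c (c ⊔ q)) → (∀ {x y} → Stable (Group._≈_ H x y)) → ∀ {x y} → Stable (Group._≈_ (H / center q H) x y)
    stable/ q H stable m g = stable λ k → m λ h → k (h g)
    injective/ : ∀ {x y} → Group._≈_ H₂/Z (φ x) (φ y) → Group._≈_ H₁/Z x y
    injective/ {x} {y} h = Group.trans H₁/Z (Coarsening.≈⇒≈′ C₁ (Group.sym H₁ (CayleyIso.φ⁻¹φ H₁ H₂ iso x)))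
      (Group.trans H₁/Z (T₂₁.cong-center h)
        (Coarsening.≈⇒≈′ C₁ (CayleyIso.φ⁻¹φ H₁ H₂ iso y)))
    iso/ : IsCayleyIso H₁/Z S₁ H₂/Z S₂ φ
    iso/ = CayleyIso.iso-coarse H₁ H₂ iso C₁ C₂ T₁₂.cong-center injective/

  -- Stable equality and its transfer to the quotients.

  stabilize : (G : Group c ℓ) → Coarsening G (ℓ ⊔ p)
  stabilize G = record
    { _≈′_ = λ x y → T (x ≈ y)
    ; isGroup′ = record
      { isMonoid = record
        { isSemigroup = record
          { isMagma = record
            { isEquivalence = record
              { refl = pure refl
              ; sym = λ m → m >>= λ e → pure (sym e)
              ; trans = λ m n → m >>= λ e → n >>= λ e′ → pure (trans e e′) }
            ; ∙-cong = λ m n → m >>= λ e → n >>= λ e′ → pure (∙-cong e e′) }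
          ; assoc = λ x y z → pure (assoc x y z) }
        ; identity = (λ x → pure (identityˡ x)) , (λ x → pure (identityʳ x)) }
      ; inverse = (λ x → pure (inverseˡ x)) , (λ x → pure (inverseʳ x))
      ; ⁻¹-cong = λ m → m >>= λ e → pure (⁻¹-cong e) }
    ; ≈⇒≈′ = pure }
    where open Group G

  pow-stabilize : (G : Group c ℓ) → ∀ x n → pow (coarse (stabilize G)) x n ≡ pow G x n
  pow-stabilize G x zero    = ≡.refl
  pow-stabilize G x (suc n) = ≡.cong (Group._∙_ G x) (pow-stabilize G x n)

  LCS-stabilize : (G : Group c ℓ) → ∀ {k x} → LCS (coarse (stabilize G)) k x → T (LCS G k x)
  LCS-stabilize G (base x)   = pure (base x)
  LCS-stabilize G (comm h g) = LCS-stabilize G h >>= λ l → pure (comm l g)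
  LCS-stabilize G one        = pure one
  LCS-stabilize G (mul h k)  = LCS-stabilize G h >>= λ l → LCS-stabilize G k >>= λ l′ → pure (mul l l′)
  LCS-stabilize G (inv h)    = LCS-stabilize G h >>= λ l → pure (inv l)
  LCS-stabilize G (resp m h) = m >>= λ e → LCS-stabilize G h >>= λ l → pure (resp e l)

  -- Besides stability, `T` adds the level of `P` to that of the equality. With `P` at the joint
  -- level of both groups, the equality absorbs the carrier, as `center` requires.
  stableQuotient : (G : Group c ℓ) (N : NormalSubgroup G) → Coarsening G (ℓ ⊔ p)
  stableQuotient G N = record
    { isGroup′ = Coarsening.isGroup′ (stabilize (G / N))
    ; ≈⇒≈′ = λ e → pure (Quot.≈⇒~ G N e) }

module _ (G₁ : Group c₁ ℓ₁) (S₁ : List (Group.Carrier G₁)) (N₁ : NormalSubgroup G₁)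
  (G₂ : Group c₂ ℓ₂) (S₂ : List (Group.Carrier G₂)) (N₂ : NormalSubgroup G₂)
  (P : Set (c₁ ⊔ ℓ₁ ⊔ c₂ ⊔ ℓ₂)) where

  private
    q₂ : Level
    q₂ = ℓ₂ ⊔ c₁ ⊔ ℓ₁

  C₂ : Coarsening G₂ (c₂ ⊔ q₂)
  C₂ = stableQuotient P G₂ N₂

  stableQuotient-tower : TorsionFree (G₂ / N₂) → (nilpotent : Nilpotent (G₂ / N₂)) →
                         CentralTower q₂ (proj₁ nilpotent) (coarse C₂)
  stableQuotient-tower torsionFree (k , trivial-LCS) = nilpotent⇒tower q₂ k (coarse C₂)
    (λ z n _ m → _>>=_ P m λ e → pure P (torsionFree z n (≡.subst (λ x → Group._≈_ (G₂ / N₂) x (Group.ε G₂)) (pow-stabilize P (G₂ / N₂) z (suc n)) e)))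
    (λ x l → _>>=_ P (LCS-stabilize P (G₂ / N₂) l) λ l′ → pure P (trivial-LCS x l′))

  iso-stable-cong : Generates G₁ S₁ → SymmetricSet G₂ S₂ → Generates G₂ S₂ →
    FiniteNormal G₁ N₁ → TorsionFree (G₂ / N₂) → Nilpotent (G₂ / N₂) → ∀ {φ} → IsCayleyIso G₁ S₁ G₂ S₂ φ →
    ∀ {x y} → T P (Group._≈_ (G₁ / N₁) x y) → T P (Group._≈_ (G₂ / N₂) (φ x) (φ y))
  iso-stable-cong generates₁ symmetric₂ generates₂ finite₁ torsionFree nilpotent iso x~y =
    _>>=_ P x~y λ e → cosets-collapse N₁ finite₁ iso e
    where open Displacement P G₁ G₂ S₁ S₂ generates₁ symmetric₂ generates₂ q₂ C₂ (λ m k → m λ e → e k)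
                 (proj₁ nilpotent) (stableQuotient-tower torsionFree nilpotent)

-- This is Friedman's trick: for `P` equal to the conclusion, the continuation demanded by `T` is
-- the identity up to `Lift`, which only adjusts the universe.
runT : ∀ p {A : Set a} → ((P : Set (a ⊔ p)) → T P A) → A
runT p {A} h = lower (h (Lift p A) lift)

theorem4p2 : ∀ {c₁ ℓ₁ c₂ ℓ₂ : Level}
    (G₁ : Group c₁ ℓ₁) (S₁ : List (Group.Carrier G₁)) (N₁ : NormalSubgroup G₁)
    (G₂ : Group c₂ ℓ₂) (S₂ : List (Group.Carrier G₂)) (N₂ : NormalSubgroup G₂) →
    SymmetricSet G₁ S₁ → Generates G₁ S₁ →
    SymmetricSet G₂ S₂ → Generates G₂ S₂ →
    FiniteNormal G₁ N₁ → TorsionFree (G₁ / N₁) → Nilpotent (G₁ / N₁) →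
    FiniteNormal G₂ N₂ → TorsionFree (G₂ / N₂) → Nilpotent (G₂ / N₂) →
    (φ : Group.Carrier G₁ → Group.Carrier G₂) → IsCayleyIso G₁ S₁ G₂ S₂ φ →
    InducesWellDefined G₁ N₁ G₂ N₂ φ × AffineBijection (G₁ / N₁) (G₂ / N₂) φ
theorem4p2 {c₁} {ℓ₁} {c₂} {ℓ₂} G₁ S₁ N₁ G₂ S₂ N₂ symmetric₁ generates₁ symmetric₂ generates₂
  finite₁ torsionFree₁ nilpotent₁ finite₂ torsionFree₂ nilpotent₂ φ iso =
    wellDefined , α , α-iso , φ ε₁ , λ x → H₂.sym {φ ε₁ ∙₂ α x} {φ x} (Quot.≈⇒~ G₂ N₂ (\\-leftDividesˡ (φ ε₁) (φ x)))
  where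
  open Group G₁ using () renaming (Carrier to X₁; _∙_ to _∙₁_; ε to ε₁)
  open Group G₂ using () renaming (Carrier to X₂; _∙_ to _∙₂_; ε to ε₂; _⁻¹ to _⁻¹₂)
  open Algebra.Properties.Group G₂ using (\\-leftDividesˡ)
  module H₁ = Group (G₁ / N₁)
  module H₂ = Group (G₂ / N₂)
  open CayleyIso G₁ G₂

  stable-cong : ∀ P {x y} → T P (H₁._≈_ x y) → T P (H₂._≈_ (φ x) (φ y))
  stable-cong P = iso-stable-cong G₁ S₁ N₁ G₂ S₂ N₂ P generates₁ symmetric₂ generates₂ finite₁ torsionFree₂ nilpotent₂ iso

  stable-injective : ∀ P {x y} → T P (H₂._≈_ (φ x) (φ y)) → T P (H₁._≈_ x y)
  stable-injective P {x} {y} φx~φy = _>>=_ P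
    (iso-stable-cong G₂ S₂ N₂ G₁ S₁ N₁ P generates₂ symmetric₁ generates₁ finite₂ torsionFree₁ nilpotent₁ (inverse iso) φx~φy)
    λ e → pure P (H₁.trans {x} {φ⁻¹ iso (φ x)} {y} (H₁.sym {φ⁻¹ iso (φ x)} {x} (Quot.≈⇒~ G₁ N₁ (φ⁻¹φ iso x)))
      (H₁.trans {φ⁻¹ iso (φ x)} {φ⁻¹ iso (φ y)} {y} e (Quot.≈⇒~ G₁ N₁ (φ⁻¹φ iso y))))

  stable-affine : ∀ P x y → T P (H₂._≈_ (φ (x ∙₁ y)) (φ x ∙₂ (φ ε₁ ⁻¹₂ ∙₂ φ y)))
  stable-affine P = affine P (ℓ₁ ⊔ c₂ ⊔ ℓ₂) (ℓ₂ ⊔ c₁ ⊔ ℓ₁) (proj₁ nilpotent₁) (proj₁ nilpotent₂) (coarse D₁) (coarse D₂)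
    (λ m k → m λ e → e k) (λ m k → m λ e → e k)
    (stableQuotient-tower G₂ S₂ N₂ G₁ S₁ N₁ P torsionFree₁ nilpotent₁)
    (stableQuotient-tower G₁ S₁ N₁ G₂ S₂ N₂ P torsionFree₂ nilpotent₂) S₁ S₂
    (Coarsening.symmetric-coarse D₁ symmetric₁) (Coarsening.generates-coarse D₁ generates₁)
    (Coarsening.symmetric-coarse D₂ symmetric₂) (Coarsening.generates-coarse D₂ generates₂) φ
    (iso-coarse iso D₁ D₂ (λ {x} {y} → stable-cong P {x} {y}) (λ {x} {y} → stable-injective P {x} {y}))
    where
    D₁ = stableQuotient P G₁ N₁
    D₂ = stableQuotient P G₂ N₂

  wellDefined : InducesWellDefined G₁ N₁ G₂ N₂ φ
  wellDefined x y e = runT (c₁ ⊔ ℓ₁ ⊔ c₂) λ P → stable-cong P {x} {y} (pure P e)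

  α : X₁ → X₂
  α x = φ ε₁ ⁻¹₂ ∙₂ φ x

  α-cong : ∀ {x y} → H₁._≈_ x y → H₂._≈_ (α x) (α y)
  α-cong {x} {y} e = H₂.∙-congˡ {φ ε₁ ⁻¹₂} {φ x} {φ y} (wellDefined x y e)

  α-∙ : ∀ x y → H₂._≈_ (α (x ∙₁ y)) (α x ∙₂ α y)
  α-∙ x y = H₂.trans {α (x ∙₁ y)} {φ ε₁ ⁻¹₂ ∙₂ (φ x ∙₂ α y)} {α x ∙₂ α y}
    (H₂.∙-congˡ {φ ε₁ ⁻¹₂} {φ (x ∙₁ y)} {φ x ∙₂ α y} (runT (c₁ ⊔ ℓ₁ ⊔ c₂) λ P → stable-affine P x y))
    (Quot.≈⇒~ G₂ N₂ (Group.sym G₂ (Group.assoc G₂ _ _ _)))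

  α-ε : H₂._≈_ (α ε₁) ε₂
  α-ε = Quot.≈⇒~ G₂ N₂ (Group.inverseˡ G₂ (φ ε₁))

  α-iso : GroupMorphisms.IsGroupIsomorphism (Group.rawGroup (G₁ / N₁)) (Group.rawGroup (G₂ / N₂)) α
  α-iso = record
    { isGroupMonomorphism = record
      { isGroupHomomorphism = record
        { isMonoidHomomorphism = record
          { isMagmaHomomorphism = record
            { isRelHomomorphism = record { cong = λ {x} {y} → α-cong {x} {y} }
            ; homo = α-∙ }
          ; ε-homo = α-ε }
        ; ⁻¹-homo = λ x → inverseˡ-unique (α (Group._⁻¹ G₁ x)) (α x)
            (H₂.trans {α (Group._⁻¹ G₁ x) ∙₂ α x} {α (Group._⁻¹ G₁ x ∙₁ x)} {ε₂} (H₂.sym {α (Group._⁻¹ G₁ x ∙₁ x)} {α (Group._⁻¹ G₁ x) ∙₂ α x} (α-∙ (Group._⁻¹ G₁ x) x))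
              (H₂.trans {α (Group._⁻¹ G₁ x ∙₁ x)} {α ε₁} {ε₂} (α-cong {Group._⁻¹ G₁ x ∙₁ x} {ε₁} (Quot.≈⇒~ G₁ N₁ (Group.inverseˡ G₁ x))) α-ε)) }
      ; injective = λ {x} {y} e → runT (ℓ₂ ⊔ c₁ ⊔ c₂) λ P → stable-injective P {x} {y} (pure P (∙-cancelˡ (φ ε₁ ⁻¹₂) (φ x) (φ y) e)) }
    ; surjective = λ y → φ⁻¹ iso (φ ε₁ ∙₂ y) , λ {z} e → H₂.trans {α z} {α (φ⁻¹ iso (φ ε₁ ∙₂ y))} {y} (α-cong {z} {φ⁻¹ iso (φ ε₁ ∙₂ y)} e)
        (Quot.≈⇒~ G₂ N₂ (Group.trans G₂ (Group.∙-congˡ G₂ (φφ⁻¹ iso _)) (Algebra.Properties.Group.\\-leftDividesʳ G₂ _ _))) }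
    where open Algebra.Properties.Group (G₂ / N₂) using (inverseˡ-unique; ∙-cancelˡ)
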